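{- Let $G$ be a connected $(P_5,C_5)$-free graph of order $n$ with minimum degree $\delta(G)\geq 3$. Then $rx_3(G)\leq \frac{11}{16}n+3$.
   Context: All graphs are finite, simple and undirected. $P_5$ is the path on $5$ vertices and $C_5$ is the cycle on $5$ vertices; a graph is $(P_5,C_5)$-free if it contains neither $P_5$ nor $C_5$ as an induced subgraph. Edge colorings are arbitrary (adjacent edges may receive the same color). In an edge-colored graph $G$, a tree $T\subseteq G$ (a subgraph that is a tree) is a rainbow tree if no two edges of $T$ have the same color. For a connected graph $G$ of order $n\ge 3$, a $3$-rainbow coloring of $G$ is an edge coloring such that for every set $S$ of $3$ vertices of $G$ there is a rainbow tree $T$ in $G$ with $S\subseteq V(T)$. The $3$-rainbow index $rx_3(G)$ is the minimum number of colors in a $3$-rainbow coloring of $G$. -}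

module Defs where

open import Data.Bool using (Bool; false; _∨_; T)
open import Data.Bool.Properties using (∨-comm)
open import Data.Fin using (Fin; zero; suc; toℕ; inject₁; fromℕ)
open import Data.Fin.Patterns using (0F; 1F; 2F; 3F; 4F)
open import Data.Fin.Subset using (Subset; _∈_; _⊆_; ⊤; ∣_∣; Nonempty)
open import Data.List using (map; allFin)
open import Data.List.Extrema.Nat using (min)
open import Data.Nat using (ℕ; suc; _+_; _≤_; _≡ᵇ_; _%_)
open import Data.Product using (∃-syntax; _×_)
open import Data.Sum using (_⊎_)
open import Data.Vec using (tabulate)
open import Function.Definitions using (Injective)
open import Level using (0ℓ)
open import Relation.Binary.Core using (Rel)
open import Relation.Binary.Construct.Closure.ReflexiveTransitive using (Star)
open import Relation.Binary.PropositionalEquality using (_≡_; refl)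
open import Relation.Nullary using (¬_)

record Graph (n : ℕ) : Set where
  field
    adj        : Fin n → Fin n → Bool
    adj-sym    : ∀ u v → adj u v ≡ adj v u
    adj-irrefl : ∀ v → adj v v ≡ false

  infix 4 _~_
  _~_ : Rel (Fin n) 0ℓ
  u ~ v = T (adj u v)

open Graph using (adj)

degree : ∀ {n} → Graph n → Fin n → ℕ
degree G v = ∣ tabulate (adj G v) ∣

-- Every degree is smaller than n, so the default value n of `min` is attained
-- only by the graph without vertices.
δ : ∀ {n} → Graph n → ℕ
δ {n} G = min n (map (degree G) (allFin n))

P₅ : Graph 5
P₅ = record
  { adj        = λ i j → next i j ∨ next j i
  ; adj-sym    = λ i j → ∨-comm (next i j) (next j i)
  ; adj-irrefl = λ { 0F → refl ; 1F → refl ; 2F → refl ; 3F → refl ; 4F → refl }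
  }
  where
  next : Fin 5 → Fin 5 → Bool
  next i j = suc (toℕ i) ≡ᵇ toℕ j

C₅ : Graph 5
C₅ = record
  { adj        = λ i j → next i j ∨ next j i
  ; adj-sym    = λ i j → ∨-comm (next i j) (next j i)
  ; adj-irrefl = λ { 0F → refl ; 1F → refl ; 2F → refl ; 3F → refl ; 4F → refl }
  }
  where
  next : Fin 5 → Fin 5 → Bool
  next i j = suc (toℕ i) % 5 ≡ᵇ toℕ j

InducedIn : ∀ {m n} → Graph m → Graph n → Set
InducedIn {m} {n} H G =
  ∃[ f ] Injective {A = Fin m} {B = Fin n} _≡_ _≡_ f
       × (∀ i j → adj G (f i) (f j) ≡ adj H i j)

P₅C₅-Free : ∀ {n} → Graph n → Set
P₅C₅-Free G = ¬ InducedIn P₅ G × ¬ InducedIn C₅ G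

-- Connectedness of the graph with vertex set V and edge relation E, where E is
-- understood to relate only vertices of V.
ConnectedOn : ∀ {n} → Subset n → Rel (Fin n) 0ℓ → Set
ConnectedOn V E = Nonempty V × (∀ {u v} → u ∈ V → v ∈ V → Star E u v)

Connected : ∀ {n} → Graph n → Set
Connected G = ConnectedOn ⊤ (Graph._~_ G)

-- A cycle on m + 3 distinct vertices f 0, …, f (m + 2).
HasCycle : ∀ {n} → Rel (Fin n) 0ℓ → Set
HasCycle {n} E =
  ∃[ m ] ∃[ f ] Injective {A = Fin (3 + m)} {B = Fin n} _≡_ _≡_ f
              × (∀ (i : Fin (2 + m)) → E (f (inject₁ i)) (f (suc i)))
              × E (f (fromℕ (2 + m))) (f zero)

record Subgraph {n : ℕ} (G : Graph n) : Set where
  field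
    vertices : Subset n
    edge     : Fin n → Fin n → Bool

  E : Rel (Fin n) 0ℓ
  E u v = T (edge u v)

  field
    edge-sym : ∀ u v → edge u v ≡ edge v u
    edge-end : ∀ {u v} → E u v → u ∈ vertices
    edge-in  : ∀ {u v} → E u v → Graph._~_ G u v

IsTree : ∀ {n} {G : Graph n} → Subgraph G → Set
IsTree S = ConnectedOn vertices E × ¬ HasCycle E
  where open Subgraph S

-- Each edge {u , v} is presented by both (u , v) and (v , u), which must get
-- the same colour; adjacent edges are not required to differ.
record EdgeColouring {n : ℕ} (G : Graph n) (k : ℕ) : Set where
  open Graph G using (_~_)
  field
    colour     : ∀ u v → u ~ v → Fin k
    colour-sym : ∀ u v (e : u ~ v) (e′ : v ~ u) → colour u v e ≡ colour v u e′

module _ {n k : ℕ} {G : Graph n} (c : EdgeColouring G k) where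
  open EdgeColouring c

  IsRainbow : Subgraph G → Set
  IsRainbow S =
    ∀ {u v x y} (e : E u v) (e′ : E x y) →
    colour u v (edge-in e) ≡ colour x y (edge-in e′) →
    (u ≡ x × v ≡ y) ⊎ (u ≡ y × v ≡ x)
    where open Subgraph S

  Is3RainbowColouring : Set
  Is3RainbowColouring =
    ∀ (S : Subset n) → ∣ S ∣ ≡ 3 →
    ∃[ t ] IsTree {G = G} t × IsRainbow t × S ⊆ Subgraph.vertices t

Has3RainbowColouring : ∀ {n} → Graph n → ℕ → Set
Has3RainbowColouring G k = ∃[ c ] Is3RainbowColouring {k = k} {G = G} c

-- r = rx₃(G).
Is3RainbowIndex : ∀ {n} → Graph n → ℕ → Set
Is3RainbowIndex G r =
  Has3RainbowColouring G r × (∀ k → Has3RainbowColouring G k → r ≤ k)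

{-# OPTIONS --safe #-}
-- A connected (P₅,C₅)-free graph has a dominating clique K. On a set D, "linked
-- with q colours" means that some partial colouring joins any three vertices of D
-- by a rainbow set of edges. A clique of order k is linked with q ≤ (k + 2) / 2
-- colours. At most half of the n − k vertices outside K suffice to dominate the
-- non-isolated vertices of G − K; attaching each of them to K by an edge of a new
-- colour gives a linked set D in which, as δ(G) ≥ 3, every other vertex has two
-- neighbours, and four more colours link the whole graph. The total is at most
-- n/2 + 5 colours. For n ≤ 12 a spanning tree with its n − 1 colours is enough.
module Submission where

open import Defs
open import Data.Bool using (Bool; true; false; T; T?; if_then_else_; _∧_; _∨_)
open import Data.Bool.Properties using (∨-comm; T-∧; T-∨; T-≡)
import Data.Bool.Properties as Bool
open import Data.Empty using (⊥; ⊥-elim)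
open import Data.Fin as Fin using (Fin; zero; suc; toℕ; fromℕ; inject₁; inject≤; _≟_; _↑ˡ_; _↑ʳ_)
open import Data.Fin.Patterns using (0F; 1F; 2F; 3F; 4F)
open import Data.Fin.Properties as FinP using (any?; all?; injective⇒≤; inject≤-injective; ↑ˡ-injective; ↑ʳ-injective)
open import Data.Fin.Subset using (Subset; ⁅_⁆; ∣_∣; _∪_) renaming (_∈_ to _∈ˢ_; _∉_ to _∉ˢ_; _⊆_ to _⊆ˢ_)
open import Data.Fin.Subset.Properties as SubsetP using (x∈⁅x⁆; x∈⁅y⁆⇒x≡y; x∈p∪q⁺; x∈p∪q⁻; anySubset?; ∣⁅x⁆∣≡1; p⊆q⇒∣p∣≤∣q∣)
import Data.Fin.Relation.Unary.Top as Top
import Data.List.Properties as ListP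
import Data.Product.Properties as ProductP
import Data.List.Relation.Unary.Any.Properties as AnyP
import Data.List.Extrema.Nat as Extrema
import Data.Integer as ℤ
import Data.Integer.Properties as ℤP
open import Data.Nat.Solver using (module +-*-Solver)
open import Data.Integer using (+_)
open import Data.List using (List; []; _∷_; [_]; _++_; length; map; filter; allFin; lookup)
open import Data.List.Membership.Propositional using (_∈_; _∉_)
open import Data.List.Membership.Propositional.Properties using (∈-++⁺ˡ; ∈-++⁺ʳ; ∈-++⁻; ∈-filter⁺; ∈-filter⁻; ∈-allFin; ∈-map⁺; ∈-map⁻; ∈-lookup)
open import Data.List.Relation.Binary.Pointwise as Pointwise using (Pointwise; []; _∷_)
open import Data.List.Relation.Unary.All as All using (All; []; _∷_)
open import Data.List.Relation.Unary.AllPairs as AllPairs using (AllPairs; []; _∷_)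
open import Data.List.Relation.Unary.Any as Any using (Any; here; there)
open import Data.List.Relation.Unary.Unique.Propositional using (Unique)
import Data.List.Relation.Unary.Unique.Propositional.Properties as Unique
import Data.List.Relation.Unary.AllPairs.Properties as AllPairsP
import Data.List.Relation.Unary.All.Properties as AllP
open import Data.Maybe using (Maybe; just; nothing)
import Data.Maybe as Maybe
open import Data.Maybe.Properties as MaybeP using (just-injective)
open import Data.Nat as ℕ using (ℕ; zero; suc; z≤n; s≤s; _≥_)
import Data.Nat.Properties as ℕP
open import Data.Product using (∃; ∃₂; ∃-syntax; _×_; _,_; proj₁; proj₂)
open import Data.Rational.Unnormalised using (_/_; _*_; _+_; _≤_; *≤*)
open import Data.Sum as Sum using (_⊎_; inj₁; inj₂; [_,_]′)
open import Data.Unit using (tt)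
open import Data.Vec as Vec using (Vec; []; _∷_; tabulate)
import Data.Vec.Properties as VecP
open import Function using (_∘_; id; case_of_)
open import Function.Bundles using (Equivalence)
open import Relation.Binary.Construct.Closure.ReflexiveTransitive as Star using (Star; ε; _◅_; _◅◅_)
open import Relation.Binary.Definitions using (tri<; tri≈; tri>)
open import Relation.Binary.PropositionalEquality using (_≡_; _≢_; refl; sym; trans; cong; cong₂; subst; subst₂; ≢-sym)
open import Relation.Nullary using (¬_; Dec; yes; no; does; contradiction)
open import Relation.Nullary.Decidable using (True; toWitness; _×-dec_; _⊎-dec_; _→-dec_; ¬?; map′; from-yes; dec-true; dec-false; decidable-stable)
open import Relation.Unary using (Decidable)
open Graph using (adj)

-- The index is a minimum, and it is obtained constructively by deciding whether a 3-rainbow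
-- colouring with a given number of colours exists; hence the finite search over matrices. The upper
-- bound works with rainbow edge sets instead of trees: such sets with disjoint colours can simply
-- be concatenated, and a tree is extracted only at the end. The total splits as (k + 2)/2 + (n -
-- k)/2 + 4, so the order k of the clique cancels. The delicate point is that three vertices outside
-- `D` must leave by disjoint colours, while the third neighbour granted by δ(G) ≥ 3 may itself lie
-- outside `D`. Splitting the outside into an independent set and the rest turns such a neighbour
-- into a detour through the other side. Multiplied by 16, the bound n/2 + 5 becomes 8n + 80, which
-- is at most 11n + 48 from n = 11 on; n - 1 colours are good enough exactly up to n = 12. The two
-- ranges overlap, so no order is left out.

module _ {n : ℕ} where
  open import Data.List.Membership.DecPropositional (_≟_ {n}) public using (_∈?_)

-- Exhaustion along a relation and reachability

AllPairs-lookup : ∀ {A : Set} {R : A → A → Set} → (∀ {x y} → R x y → R y x) →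
  ∀ {xs} → AllPairs R xs → ∀ {x y} → x ∈ xs → y ∈ xs → x ≢ y → R x y
AllPairs-lookup s (_ ∷ _)  (here refl) (here refl) x≢y = contradiction refl x≢y
AllPairs-lookup s (r ∷ _)  (here refl) (there q)   _   = All.lookup r q
AllPairs-lookup s (r ∷ _)  (there p)   (here refl) _   = s (All.lookup r p)
AllPairs-lookup s (_ ∷ rs) (there p)   (there q)   x≢y = AllPairs-lookup s rs p q x≢y

Unique-lookup-injective : ∀ {A : Set} {xs : List A} → Unique xs →
  ∀ i j → lookup xs i ≡ lookup xs j → i ≡ j
Unique-lookup-injective (_ ∷ _) zero    zero    _  = refl
Unique-lookup-injective (p ∷ _) zero    (suc j) eq = contradiction eq (All.lookup p (∈-lookup j))
Unique-lookup-injective (p ∷ _) (suc i) zero    eq = contradiction (sym eq) (All.lookup p (∈-lookup i))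
Unique-lookup-injective (_ ∷ u) (suc i) (suc j) eq = cong suc (Unique-lookup-injective u i j eq)

Unique⇒length≤ : ∀ {n} {xs : List (Fin n)} → Unique xs → length xs ℕ.≤ n
Unique⇒length≤ u = injective⇒≤ (λ {i} {j} → Unique-lookup-injective u i j)

∉⇒Unique-∷ : ∀ {A : Set} {x : A} {xs} → x ∉ xs → Unique xs → Unique (x ∷ xs)
∉⇒Unique-∷ x∉ u = AllP.¬Any⇒All¬ _ x∉ ∷ u

Closed : ∀ {n} → (Fin n → Fin n → Bool) → (Fin n → Set) → Set
Closed ρ P = ∀ {u v} → P u → T (ρ u v) → P v

Closed-Star : ∀ {n} {ρ : Fin n → Fin n → Bool} {P} → Closed ρ P →
  ∀ {u v} → P u → Star (λ x y → T (ρ x y)) u v → P v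
Closed-Star cl p ε        = p
Closed-Star cl p (e ◅ es) = Closed-Star cl (cl p e) es

-- The invariant `P` is an arbitrary property of the list, so this one exhaustion serves
-- reachability, spanning trees, the dominating clique and the linking of a connected graph.
grow : ∀ {n} (ρ : Fin n → Fin n → Bool) (P : List (Fin n) → Set) (a : Fin n) → P [ a ] →
  (∀ {l u v} → u ∈ l → v ∉ l → T (ρ u v) → P l → P (v ∷ l)) →
  ∃[ l ] P l × Unique l × a ∈ l × Closed ρ (_∈ l)
-- `length l + m` stays n + 1, so running out of fuel would leave a duplicate-free list of n + 1
-- vertices.
grow {n} ρ P a base step = go n (ℕP.+-comm 1 n) base ([] ∷ []) (here refl)
  where
  go : ∀ {l} m → length l ℕ.+ m ≡ n ℕ.+ 1 → P l → Unique l → a ∈ l →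
    ∃[ l ] P l × Unique l × a ∈ l × Closed ρ (_∈ l)
  go {l} m eq p u a∈ with any? (λ w → any? (λ v → (w ∈? l) ×-dec ¬? (v ∈? l) ×-dec T? (ρ w v)))
  ... | no none = l , p , u , a∈ , closed
    where
    closed : Closed ρ (_∈ l)
    closed {w} {v} w∈ e with v ∈? l
    ... | yes v∈ = v∈
    ... | no v∉  = contradiction (w , v , w∈ , v∉ , e) none
  go {l} zero eq p u a∈ | yes _ =
    contradiction (Unique⇒length≤ u) (ℕP.<⇒≱ (ℕP.≤-reflexive (trans (ℕP.+-comm 1 n)
      (sym (trans (sym (ℕP.+-identityʳ _)) eq)))))
  go {l} (suc m) eq p u a∈ | yes (w , v , w∈ , v∉ , e) =
    go m (trans (sym (ℕP.+-suc _ m)) eq) (step w∈ v∉ e p) (∉⇒Unique-∷ v∉ u) (there a∈)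

star? : ∀ {n} (ρ : Fin n → Fin n → Bool) a b → Dec (Star (λ u v → T (ρ u v)) a b)
star? ρ a b with grow ρ (λ l → ∀ {v} → v ∈ l → Star (λ u v → T (ρ u v)) a v) a
  (λ { (here refl) → ε })
  (λ { w∈ _ e p (here refl) → p w∈ ◅◅ e ◅ ε ; w∈ _ e p (there v∈) → p v∈ })
... | l , p , _ , a∈ , cl = map′ p (Closed-Star {ρ = ρ} cl a∈) (b ∈? l)

-- Pendant vertices and spanning trees

cycle-neighbours : ∀ {n} {E : Fin n → Fin n → Set} → (∀ {u v} → E u v → E v u) →
  ((m , f , _) : HasCycle E) (i : Fin (3 ℕ.+ m)) →
  ∃₂ λ j k → j ≢ k × E (f i) (f j) × E (f i) (f k)
cycle-neighbours s (m , f , _ , step , last) zero =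
  suc zero , fromℕ _ , (λ ()) , step zero , s last
cycle-neighbours s (m , f , _ , step , last) (suc i) with Top.view i
... | Top.‵fromℕ = inject₁ (fromℕ (suc m)) , zero , (λ ()) , s (step (fromℕ _)) , last
... | Top.‵inject₁ i′ = inject₁ (inject₁ i′) , suc (suc i′) , ne , s (step (inject₁ i′)) , step (suc i′)
  where
  ne : inject₁ (inject₁ i′) ≢ suc (suc i′)
  ne eq = ℕP.m≢1+m+n (toℕ i′) (trans
    (sym (trans (FinP.toℕ-inject₁ (inject₁ i′)) (FinP.toℕ-inject₁ i′)))
    (trans (cong toℕ eq) (cong suc (ℕP.+-comm 1 (toℕ i′)))))

joins : ∀ {n} → Fin n → Fin n → Fin n → Fin n → Bool
joins p x u v = (does (u ≟ p) ∧ does (v ≟ x)) ∨ (does (u ≟ x) ∧ does (v ≟ p))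

joins-sym : ∀ {n} (p x u v : Fin n) → joins p x u v ≡ joins p x v u
joins-sym p x u v = trans (∨-comm (does (u ≟ p) ∧ does (v ≟ x)) _)
  (cong₂ _∨_ (Bool.∧-comm (does (u ≟ x)) _) (Bool.∧-comm (does (u ≟ p)) _))

T-does : ∀ {P : Set} (d : Dec P) → T (does d) → P
T-does (yes p) _ = p

does-T : ∀ {P : Set} (d : Dec P) → P → T (does d)
does-T (yes _) _ = tt
does-T (no ¬p) p = ¬p p

T-∨⁻ : ∀ x {y} → T (x ∨ y) → T x ⊎ T y
T-∨⁻ x = Equivalence.to (T-∨ {x})

T-∨⁺ : ∀ x {y} → T x ⊎ T y → T (x ∨ y)
T-∨⁺ x = Equivalence.from (T-∨ {x})

joins⁻ : ∀ {n} {p x u v : Fin n} → T (joins p x u v) → (u ≡ p × v ≡ x) ⊎ (u ≡ x × v ≡ p)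
joins⁻ {p = p} {x} {u} {v} e with T-∨⁻ (does (u ≟ p) ∧ does (v ≟ x)) e
... | inj₁ e′ = let a , b = Equivalence.to (T-∧ {does (u ≟ p)}) e′ in inj₁ (T-does (u ≟ p) a , T-does (v ≟ x) b)
... | inj₂ e′ = let a , b = Equivalence.to (T-∧ {does (u ≟ x)}) e′ in inj₂ (T-does (u ≟ x) a , T-does (v ≟ p) b)

joins-refl : ∀ {n} (p x : Fin n) → T (joins p x p x)
joins-refl p x = T-∨⁺ (does (p ≟ p) ∧ does (x ≟ x))
  (inj₁ (Equivalence.from (T-∧ {does (p ≟ p)}) (does-T (p ≟ p) refl , does-T (x ≟ x) refl)))

module _ {n : ℕ} {G : Graph n} where
  open Graph G using (_~_)
  open Subgraph

  point : Fin n → Subgraph G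
  point a = record
    { vertices = ⁅ a ⁆ ; edge = λ _ _ → false ; edge-sym = λ _ _ → refl
    ; edge-end = λ () ; edge-in = λ () }

  point-tree : ∀ a → IsTree (point a)
  point-tree a = ((a , x∈⁅x⁆ a) , conn) , λ { (_ , _ , _ , _ , ()) }
    where
    conn : ∀ {u v} → u ∈ˢ ⁅ a ⁆ → v ∈ˢ ⁅ a ⁆ → Star (E (point a)) u v
    conn u∈ v∈ with refl ← x∈⁅y⁆⇒x≡y a u∈ | refl ← x∈⁅y⁆⇒x≡y a v∈ = ε

  module _ (t : Subgraph G) {p x : Fin n} (p∈ : p ∈ˢ vertices t) (p~x : p ~ x) where

    leaf : Subgraph G
    leaf = record
      { vertices = vertices t ∪ ⁅ x ⁆
      ; edge     = λ u v → joins p x u v ∨ edge t u v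
      ; edge-sym = λ u v → cong₂ _∨_ (joins-sym p x u v) (edge-sym t u v)
      ; edge-end = λ {u} {v} e → case T-∨⁻ (joins p x u v) e of λ
          { (inj₁ j) → case joins⁻ {p = p} {x} {u} {v} j of λ
              { (inj₁ (refl , _)) → x∈p∪q⁺ (inj₁ p∈)
              ; (inj₂ (refl , _)) → x∈p∪q⁺ (inj₂ (x∈⁅x⁆ x)) }
          ; (inj₂ e′) → x∈p∪q⁺ (inj₁ (edge-end t e′)) }
      ; edge-in  = λ {u} {v} e → case T-∨⁻ (joins p x u v) e of λ
          { (inj₁ j) → case joins⁻ {p = p} {x} {u} {v} j of λ
              { (inj₁ (refl , refl)) → p~x
              ; (inj₂ (refl , refl)) → subst T (Graph.adj-sym G p x) p~x }
          ; (inj₂ e′) → edge-in t e′ } }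

    -- The only neighbour of `x` is `p`, whereas a vertex of a cycle has two neighbours on it. A
    -- cycle therefore avoids `x` and already lies in `t`.
    leaf-tree : IsTree t → x ∉ˢ vertices t → IsTree leaf
    leaf-tree ((ne , conn) , acyclic) x∉ = (ne′ , conn′) , acyclic′
      where
      old : ∀ {u v} → E t u v → E leaf u v
      old {u} {v} e = T-∨⁺ (joins p x u v) (inj₂ e)

      new : E leaf p x
      new = T-∨⁺ (joins p x p x) (inj₁ (joins-refl p x))

      sym′ : ∀ {u v} → E leaf u v → E leaf v u
      sym′ {u} {v} = subst T (edge-sym leaf u v)

      ne′ = let w , w∈ = ne in w , x∈p∪q⁺ (inj₁ w∈)

      to-p : ∀ {u} → u ∈ˢ vertices leaf → Star (E leaf) u p
      to-p u∈ with x∈p∪q⁻ _ _ u∈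
      ... | inj₁ u∈t = Star.map (λ {u} {v} → old {u} {v}) (conn u∈t p∈)
      ... | inj₂ u∈x with refl ← x∈⁅y⁆⇒x≡y x u∈x = sym′ {p} {x} new ◅ ε

      conn′ : ∀ {u v} → u ∈ˢ vertices leaf → v ∈ˢ vertices leaf → Star (E leaf) u v
      conn′ u∈ v∈ = to-p u∈ ◅◅ Star.reverse (λ {u} {v} → sym′ {u} {v}) (to-p v∈)

      at-x : ∀ {v} → E leaf x v → v ≡ p
      at-x {v} e with T-∨⁻ (joins p x x v) e
      ... | inj₂ e′ = contradiction (edge-end t e′) x∉
      ... | inj₁ j with joins⁻ {p = p} {x} {x} {v} j
      ...   | inj₁ (refl , refl) = refl
      ...   | inj₂ (_ , eq)    = eq

      off-x : ∀ {u v} → u ≢ x → v ≢ x → E leaf u v → E t u v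
      off-x {u} {v} u≢ v≢ e with T-∨⁻ (joins p x u v) e
      ... | inj₂ e′ = e′
      ... | inj₁ j with joins⁻ {p = p} {x} {u} {v} j
      ...   | inj₁ (_ , eq) = contradiction eq v≢
      ...   | inj₂ (eq , _) = contradiction eq u≢

      acyclic′ : ¬ HasCycle (E leaf)
      acyclic′ c@(m , f , inj , step , last) with any? (λ i → f i ≟ x)
      ... | yes (i , refl) =
        let j , k , j≢k , ej , ek = cycle-neighbours (λ {u} {v} → sym′ {u} {v}) c i
        in j≢k (inj (trans (at-x ej) (sym (at-x ek))))
      ... | no none = acyclic (m , f , inj ,
        (λ i → off-x (avoid _) (avoid _) (step i)) , off-x (avoid _) (avoid _) last)
        where
        avoid : ∀ i → f i ≢ x
        avoid i eq = none (i , eq)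

  -- Every newly reached vertex is hung on as a leaf, so the result is acyclic even if `ρ` contains
  -- cycles.
  spanning-tree : (ρ : Fin n → Fin n → Bool) → (∀ u v → ρ u v ≡ ρ v u) → (∀ {u v} → T (ρ u v) → u ~ v) →
    (a : Fin n) → ∃[ t ] IsTree {G = G} t × (∀ {u v} → E t u v → T (ρ u v)) ×
      (∀ {v} → Star (λ u v → T (ρ u v)) a v → v ∈ˢ vertices t)
  spanning-tree ρ ρ-sym ρ⊆~ a with grow ρ P a base step
    where
    P : List (Fin n) → Set
    P l = ∃[ t ] IsTree {G = G} t × (∀ {u v} → E t u v → T (ρ u v)) ×
      (∀ {v} → v ∈ l → v ∈ˢ vertices t) × (∀ {v} → v ∈ˢ vertices t → v ∈ l)
    base : P [ a ]
    base = point a , point-tree a , (λ ()) , (λ { (here refl) → x∈⁅x⁆ a }) , here ∘ x∈⁅y⁆⇒x≡y a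
    step : ∀ {l u v} → u ∈ l → v ∉ l → T (ρ u v) → P l → P (v ∷ l)
    step {l} {p} {x} p∈ x∉ e (t , tree , t⊆ρ , to , from) =
      leaf t (to p∈) (ρ⊆~ e) , leaf-tree t (to p∈) (ρ⊆~ e) tree (x∉ ∘ from) , sub , to′ , from′
      where
      sub : ∀ {u v} → E (leaf t (to p∈) (ρ⊆~ e)) u v → T (ρ u v)
      sub {u} {v} e′ with T-∨⁻ (joins p x u v) e′
      ... | inj₂ e″ = t⊆ρ e″
      ... | inj₁ j with joins⁻ {p = p} {x} {u} {v} j
      ...   | inj₁ (refl , refl) = e
      ...   | inj₂ (refl , refl) = subst T (ρ-sym p x) e
      to′ : ∀ {v} → v ∈ x ∷ l → v ∈ˢ vertices t ∪ ⁅ x ⁆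
      to′ (here refl) = x∈p∪q⁺ (inj₂ (x∈⁅x⁆ x))
      to′ (there v∈)  = x∈p∪q⁺ (inj₁ (to v∈))
      from′ : ∀ {v} → v ∈ˢ vertices t ∪ ⁅ x ⁆ → v ∈ x ∷ l
      from′ v∈ with x∈p∪q⁻ _ _ v∈
      ... | inj₁ v∈t = there (from v∈t)
      ... | inj₂ v∈x = here (x∈⁅y⁆⇒x≡y x v∈x)
  ... | l , (t , tree , t⊆ρ , to , _) , _ , a∈ , cl =
    t , tree , t⊆ρ , to ∘ Closed-Star {ρ = ρ} cl a∈

-- Deciding the existence of a 3-rainbow colouring

least : ∀ {P : ℕ → Set} → Decidable P → ∀ k → P k → ∃[ r ] P r × (∀ j → P j → r ℕ.≤ j)
least {P} P? k p = go k 0 (λ _ _ → z≤n) (subst P (sym (ℕP.+-identityʳ k)) p)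
  where
  go : ∀ m i → (∀ j → P j → i ℕ.≤ j) → P (m ℕ.+ i) → ∃[ r ] P r × (∀ j → P j → r ℕ.≤ j)
  go zero    i low p = i , p , low
  go (suc m) i low p with P? i
  ... | yes q = i , q , low
  ... | no ¬q = go m (suc i) (λ j q → ℕP.≤∧≢⇒< (low j q) λ { refl → ¬q q }) (subst P (sym (ℕP.+-suc m i)) p)

Searchable : Set → Set₁
Searchable A = ∀ {P : A → Set} → Decidable P → Dec (∃ P)

search-Bool : Searchable Bool
search-Bool P? = map′ (λ { (inj₁ p) → true , p ; (inj₂ p) → false , p })
  (λ { (true , p) → inj₁ p ; (false , p) → inj₂ p }) (P? true ⊎-dec P? false)

search-Maybe : ∀ {A} → Searchable A → Searchable (Maybe A)
search-Maybe s P? = map′ (λ { (inj₁ p) → nothing , p ; (inj₂ (x , p)) → just x , p })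
  (λ { (nothing , p) → inj₁ p ; (just x , p) → inj₂ (x , p) }) (P? nothing ⊎-dec s (P? ∘ just))

search-Vec : ∀ {A} → Searchable A → ∀ n → Searchable (Vec A n)
search-Vec s zero    P? = map′ ([] ,_) (λ { ([] , p) → p }) (P? [])
search-Vec s (suc n) P? = map′ (λ (x , xs , p) → x ∷ xs , p) (λ { (x ∷ xs , p) → x , xs , p })
  (s (λ x → search-Vec s n (P? ∘ (x ∷_))))

-- A function and its tabulated matrix agree only pointwise, so `P` has to respect pointwise
-- equality.
search-matrix : ∀ {A n} {P : (Fin n → Fin n → A) → Set} → Searchable A →
  (∀ {f g} → (∀ u v → f u v ≡ g u v) → P f → P g) → Decidable P → Dec (∃ P)
search-matrix {A} {n} {P} s resp P? = map′
  (λ (m , p) → (λ u v → Vec.lookup (Vec.lookup m u) v) , p)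
  (λ (f , p) → tabulate (λ u → tabulate (f u)) , resp (λ u v → sym (trans
    (cong (λ r → Vec.lookup r v) (VecP.lookup∘tabulate (λ u → tabulate (f u)) u))
    (VecP.lookup∘tabulate (f u) v))) p)
  (search-Vec (search-Vec s n) n (λ m → P? (λ u v → Vec.lookup (Vec.lookup m u) v)))

allSubset? : ∀ {n} {P : Subset n → Set} → Decidable P → Dec (∀ S → P S)
allSubset? P? with anySubset? (¬? ∘ P?)
... | yes (S , ¬p) = no (λ all → ¬p (all S))
... | no none      = yes (λ S → decidable-stable (P? S) (λ ¬p → none (S , ¬p)))

Subset-elements : ∀ {n} (S : Subset n) →
  ∃[ l ] length l ≡ ∣ S ∣ × (∀ {v} → v ∈ˢ S → v ∈ l) × (∀ {v} → v ∈ l → v ∈ˢ S)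
Subset-elements [] = [] , refl , (λ ()) , λ ()
Subset-elements (false ∷ S) with Subset-elements S
... | l , len , to , from = map suc l , trans (ListP.length-map suc l) len ,
  (λ { (Vec.there v∈) → ∈-map⁺ suc (to v∈) }) ,
  λ v∈ → case ∈-map⁻ suc v∈ of λ { (_ , w∈ , refl) → Vec.there (from w∈) }
Subset-elements (true ∷ S) with Subset-elements S
... | l , len , to , from = zero ∷ map suc l , cong suc (trans (ListP.length-map suc l) len) ,
  (λ { Vec.here → here refl ; (Vec.there v∈) → there (∈-map⁺ suc (to v∈)) }) ,
  λ { (here refl) → Vec.here
    ; (there v∈) → case ∈-map⁻ suc v∈ of λ { (_ , w∈ , refl) → Vec.there (from w∈) } }

module _ {n : ℕ} (G : Graph n) where
  open Graph G using (_~_)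

  -- Boolean matrices stand for subgraphs, so that their existence can be
  -- searched for; acyclicity is dropped because a spanning tree can be extracted.
  record Connects {C : Set} (M : Fin n → Fin n → C) (S : Subset n) (ρ : Fin n → Fin n → Bool) : Set where
    constructor connects
    field
      symmetric : ∀ u v → ρ u v ≡ ρ v u
      within    : ∀ u v → T (ρ u v) → u ~ v
      rainbow   : ∀ u v x y → T (ρ u v) → T (ρ x y) → M u v ≡ M x y → (u ≡ x × v ≡ y) ⊎ (u ≡ y × v ≡ x)
      linked    : ∀ u v → u ∈ˢ S → v ∈ˢ S → Star (λ u v → T (ρ u v)) u v

  Connects-resp : ∀ {C : Set} {M N : Fin n → Fin n → C} {S ρ σ} → (∀ u v → M u v ≡ N u v) →
    (∀ u v → ρ u v ≡ σ u v) → Connects M S ρ → Connects N S σ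
  Connects-resp {ρ = ρ} {σ} M≗N ρ≗σ (connects s w r l) = connects
    (λ u v → trans (sym (ρ≗σ u v)) (trans (s u v) (ρ≗σ v u)))
    (λ u v → w u v ∘ back)
    (λ u v x y e e′ eq → r u v x y (back e) (back e′) (trans (M≗N u v) (trans eq (sym (M≗N x y)))))
    (λ u v u∈ v∈ → Star.map (λ {u} {v} → subst T (ρ≗σ u v)) (l u v u∈ v∈))
    where
    back : ∀ {u v} → T (σ u v) → T (ρ u v)
    back {u} {v} = subst T (sym (ρ≗σ u v))

  connects? : ∀ {k} (M : Fin n → Fin n → Maybe (Fin k)) S ρ → Dec (Connects M S ρ)
  connects? M S ρ = map′ (λ (s , w , r , l) → connects s w r l) (λ (connects s w r l) → s , w , r , l)
    (all? (λ u → all? (λ v → ρ u v Bool.≟ ρ v u))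
    ×-dec all? (λ u → all? (λ v → T? (ρ u v) →-dec T? (adj G u v)))
    ×-dec all? (λ u → all? (λ v → all? (λ x → all? (λ y → T? (ρ u v) →-dec (T? (ρ x y) →-dec
      (MaybeP.≡-dec _≟_ (M u v) (M x y) →-dec
        (((u ≟ x) ×-dec (v ≟ y)) ⊎-dec ((u ≟ y) ×-dec (v ≟ x)))))))))
    ×-dec all? (λ u → all? (λ v → (u SubsetP.∈? S) →-dec ((v SubsetP.∈? S) →-dec star? ρ u v))))

  -- Entries are `Maybe` because non-edges need an entry too, and `Fin k` offers none when `k` is 0.
  RainbowMatrix : ∀ {k} → (Fin n → Fin n → Maybe (Fin k)) → Set
  RainbowMatrix M = (∀ u v → M u v ≡ M v u) × (∀ u v → u ~ v → ∃[ i ] M u v ≡ just i) ×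
    (∀ S → ∣ S ∣ ≡ 3 → ∃ (Connects M S))

  rainbowMatrix? : ∀ {k} → Decidable (RainbowMatrix {k})
  rainbowMatrix? M =
    all? (λ u → all? (λ v → MaybeP.≡-dec _≟_ (M u v) (M v u)))
    ×-dec all? (λ u → all? (λ v → T? (adj G u v) →-dec any? (λ i → MaybeP.≡-dec _≟_ (M u v) (just i))))
    ×-dec allSubset? (λ S → (∣ S ∣ ℕ.≟ 3) →-dec
      search-matrix search-Bool (Connects-resp (λ _ _ → refl)) (connects? M S))

  RainbowMatrix-resp : ∀ {k} {M N : Fin n → Fin n → Maybe (Fin k)} → (∀ u v → M u v ≡ N u v) →
    RainbowMatrix M → RainbowMatrix N
  RainbowMatrix-resp M≗N (s , d , c) =
    (λ u v → trans (sym (M≗N u v)) (trans (s u v) (M≗N v u))) ,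
    (λ u v e → let i , eq = d u v e in i , trans (sym (M≗N u v)) eq) ,
    λ S ∣S∣ → let ρ , con = c S ∣S∣ in ρ , Connects-resp M≗N (λ _ _ → refl) con

  matrix⇒colouring : ∀ {k} → ∃ (RainbowMatrix {k}) → Has3RainbowColouring G k
  matrix⇒colouring {k} (M , M-sym , M-def , M-con) = c , trees
    where
    c : EdgeColouring G k
    c = record
      { colour     = λ u v e → proj₁ (M-def u v e)
      ; colour-sym = λ u v e e′ → just-injective
          (trans (sym (proj₂ (M-def u v e))) (trans (M-sym u v) (proj₂ (M-def v u e′)))) }

    trees : Is3RainbowColouring {G = G} c
    trees S ∣S∣ with M-con S ∣S∣ | Subset-elements S
    -- The spanning tree needs a root in `S`; having three elements, `S` provides one.
    ... | _ | [] , len , _ = case trans len ∣S∣ of λ ()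
    ... | ρ , connects s w r l | a ∷ _ , _ , _ , from =
      let t , tree , t⊆ρ , reach = spanning-tree ρ s (λ {u} {v} → w u v) a
      in t , tree ,
         (λ {u} {v} {x} {y} e e′ eq → r u v x y (t⊆ρ e) (t⊆ρ e′)
           (trans (proj₂ (M-def u v _)) (trans (cong just eq) (sym (proj₂ (M-def x y _)))))) ,
         λ v∈ → reach (l a _ (from (here refl)) v∈)

  colouring⇒matrix : ∀ {k} → Has3RainbowColouring G k → ∃ (RainbowMatrix {k})
  colouring⇒matrix {k} (c , trees) = M , M-sym , (λ u v e → _ , M-adj u v e) , con
    where
    open EdgeColouring c
    entry : ∀ u v → Dec (u ~ v) → Maybe (Fin k)
    entry u v (yes e) = just (colour u v e)
    entry u v (no _)  = nothing

    M : Fin n → Fin n → Maybe (Fin k)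
    M u v = entry u v (T? (adj G u v))

    M-adj : ∀ u v (e : u ~ v) → M u v ≡ just (colour u v e)
    M-adj u v e with T? (adj G u v)
    ... | yes e′ = cong (λ e → just (colour u v e)) (Bool.T-irrelevant e′ e)
    ... | no ¬e  = contradiction e ¬e

    M-sym : ∀ u v → M u v ≡ M v u
    M-sym u v with T? (adj G u v) | T? (adj G v u)
    ... | yes e | yes e′ = cong just (colour-sym u v e e′)
    ... | yes e | no ¬e′ = contradiction (subst T (Graph.adj-sym G u v) e) ¬e′
    ... | no ¬e | yes e′ = contradiction (subst T (Graph.adj-sym G v u) e′) ¬e
    ... | no _  | no _   = refl

    con : ∀ S → ∣ S ∣ ≡ 3 → ∃ (Connects M S)
    con S ∣S∣ with trees S ∣S∣
    ... | t , ((_ , conn) , _) , rainbow , S⊆t = Subgraph.edge t , connects (Subgraph.edge-sym t)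
      (λ _ _ → Subgraph.edge-in t)
      (λ u v x y e e′ eq → rainbow e e′ (just-injective
        (trans (sym (M-adj u v _)) (trans eq (M-adj x y _)))))
      λ _ _ u∈ v∈ → conn (S⊆t u∈) (S⊆t v∈)

  has3RainbowColouring? : Decidable (Has3RainbowColouring G)
  has3RainbowColouring? k = map′ matrix⇒colouring colouring⇒matrix
    (search-matrix (search-Maybe any?) RainbowMatrix-resp rainbowMatrix?)

-- Disjoint label lists, the pentagon colouring, induced subgraphs

Apart : ∀ {A : Set} → List A → List A → Set
Apart ls ms = All (λ l → All (l ≢_) ms) ls

apart? : ∀ {p} (ls ms : List (Fin p)) → Dec (Apart ls ms)
apart? ls ms = All.all? (λ l → All.all? (λ m → ¬? (l ≟ m)) ms) ls

Unique-++ : ∀ {A : Set} {ls ms : List A} → Unique ls → Unique ms → (∀ {x} → x ∈ ls → x ∉ ms) → Unique (ls ++ ms)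
Unique-++ u u′ disj = Unique.++⁺ u u′ (λ (p , q) → disj p q)

-- The edge colouring of the complete graph on five vertices that witnesses R(3,3) > 5.
pentagon : Fin 5 → Fin 5 → Fin 2
pentagon i j = if adj C₅ i j then zero else suc zero

-- Neither C₅ nor its complement, again a 5-cycle, contains a triangle.
pentagon-no-mono : ∀ i j l → i ≢ j → i ≢ l → j ≢ l →
  pentagon i j ≢ pentagon j l ⊎ pentagon i j ≢ pentagon i l
pentagon-no-mono = from-yes (all? λ i → all? λ j → all? λ l →
  ¬? (i ≟ j) →-dec (¬? (i ≟ l) →-dec (¬? (j ≟ l) →-dec
    (¬? (pentagon i j ≟ pentagon j l) ⊎-dec ¬? (pentagon i j ≟ pentagon i l)))))

∣p∪q∣≤∣p∣+∣q∣ : ∀ {n} (p q : Subset n) → ∣ p ∪ q ∣ ℕ.≤ ∣ p ∣ ℕ.+ ∣ q ∣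
∣p∪q∣≤∣p∣+∣q∣ []          []          = z≤n
∣p∪q∣≤∣p∣+∣q∣ (false ∷ p) (false ∷ q) = ∣p∪q∣≤∣p∣+∣q∣ p q
∣p∪q∣≤∣p∣+∣q∣ (false ∷ p) (true ∷ q)  =
  ℕP.≤-trans (s≤s (∣p∪q∣≤∣p∣+∣q∣ p q)) (ℕP.≤-reflexive (sym (ℕP.+-suc ∣ p ∣ ∣ q ∣)))
∣p∪q∣≤∣p∣+∣q∣ (true ∷ p)  (false ∷ q) = s≤s (∣p∪q∣≤∣p∣+∣q∣ p q)
∣p∪q∣≤∣p∣+∣q∣ (true ∷ p)  (true ∷ q)  =
  s≤s (ℕP.≤-trans (∣p∪q∣≤∣p∣+∣q∣ p q) (ℕP.+-monoʳ-≤ ∣ p ∣ (ℕP.n≤1+n ∣ q ∣)))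

¬T⇒≡false : ∀ {b} → ¬ T b → b ≡ false
¬T⇒≡false {false} _  = refl
¬T⇒≡false {true}  ¬t = contradiction tt ¬t

TwinFree : ∀ {m} → Graph m → Set
TwinFree H = ∀ i j → (∀ l → adj H i l ≡ adj H j l) → i ≡ j

twinFree? : ∀ {m} (H : Graph m) → Dec (TwinFree H)
twinFree? H = all? λ i → all? λ j → all? (λ l → adj H i l Bool.≟ adj H j l) →-dec (i ≟ j)

-- Vertices with the same image are twins, so injectivity is automatic.
induced : ∀ {m n} {H : Graph m} {G : Graph n} → TwinFree H → (f : Fin m → Fin n) →
  (∀ i j → i Fin.< j → adj G (f i) (f j) ≡ adj H i j) → InducedIn H G
induced {H = H} {G} twinFree f upper = f , (λ {i} {j} eq → twinFree i j λ l →
    trans (sym (agree i l)) (trans (cong (λ v → adj G v (f l)) eq) (agree j l))) , agree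
  where
  agree : ∀ i j → adj G (f i) (f j) ≡ adj H i j
  agree i j with FinP.<-cmp i j
  ... | tri< i<j _ _  = upper i j i<j
  ... | tri≈ _ refl _ = trans (Graph.adj-irrefl G (f i)) (sym (Graph.adj-irrefl H i))
  ... | tri> _ _ j<i  = trans (Graph.adj-sym G (f i) (f j)) (trans (upper j i j<i) (Graph.adj-sym H j i))

upper-pairs : ∀ {R : Fin 5 → Fin 5 → Set} →
  R 0F 1F → R 0F 2F → R 0F 3F → R 0F 4F → R 1F 2F → R 1F 3F → R 1F 4F → R 2F 3F → R 2F 4F → R 3F 4F →
  ∀ i j → i Fin.< j → R i j
upper-pairs r _ _ _ _ _ _ _ _ _ 0F 1F (s≤s z≤n)                   = r
upper-pairs _ r _ _ _ _ _ _ _ _ 0F 2F (s≤s z≤n)                   = r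
upper-pairs _ _ r _ _ _ _ _ _ _ 0F 3F (s≤s z≤n)                   = r
upper-pairs _ _ _ r _ _ _ _ _ _ 0F 4F (s≤s z≤n)                   = r
upper-pairs _ _ _ _ r _ _ _ _ _ 1F 2F (s≤s (s≤s z≤n))             = r
upper-pairs _ _ _ _ _ r _ _ _ _ 1F 3F (s≤s (s≤s z≤n))             = r
upper-pairs _ _ _ _ _ _ r _ _ _ 1F 4F (s≤s (s≤s z≤n))             = r
upper-pairs _ _ _ _ _ _ _ r _ _ 2F 3F (s≤s (s≤s (s≤s z≤n)))       = r
upper-pairs _ _ _ _ _ _ _ _ r _ 2F 4F (s≤s (s≤s (s≤s z≤n)))       = r
upper-pairs _ _ _ _ _ _ _ _ _ r 3F 4F (s≤s (s≤s (s≤s (s≤s z≤n)))) = r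

-- Linked vertex sets and their extension by new colours

module _ {n : ℕ} (G : Graph n) where
  open Graph G using (_~_)

  private
    V : Set
    V = Fin n

  ~-sym : ∀ {u v} → u ~ v → v ~ u
  ~-sym {u} {v} = subst T (Graph.adj-sym G u v)

  ~⇒≢ : ∀ {u v} → u ~ v → u ≢ v
  ~⇒≢ {u} e refl = subst T (Graph.adj-irrefl G u) e

  Conn : List (V × V) → V → V → Set
  Conn L = Star (λ u v → (u , v) ∈ L ⊎ (v , u) ∈ L)

  Conn-sym : ∀ {L u v} → Conn L u v → Conn L v u
  Conn-sym = Star.reverse Sum.swap

  Conn-⊆ : ∀ {L L′ u v} → (∀ {e} → e ∈ L → e ∈ L′) → Conn L u v → Conn L′ u v
  Conn-⊆ sub = Star.map (Sum.map sub sub)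

  Conn-here : ∀ {L u v} → Conn ((u , v) ∷ L) u v
  Conn-here = inj₁ (here refl) ◅ ε

  -- Both ends are kept in `D` because a later colouring agrees with `M`, up to renaming of colours,
  -- only between vertices of `D`.
  record ColouredIn {C : Set} (M : V → V → Maybe C) (D : List V) (e : V × V) (c : C) : Set where
    constructor coloured
    field
      is-edge : proj₁ e ~ proj₂ e
      start∈  : proj₁ e ∈ D
      end∈    : proj₂ e ∈ D
      hue     : M (proj₁ e) (proj₂ e) ≡ just c

  -- With the colours listed in parallel to the edges, being rainbow is just `Unique cs`, and the
  -- set need not be a tree.
  Joins : ∀ {C : Set} → (V → V → Maybe C) → List V → V → V → V → Set
  Joins M D a b d = ∃₂ λ L cs → Pointwise (ColouredIn M D) L cs × Unique cs × Conn L a b × Conn L a d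

  AllJoined : ∀ {C : Set} → (V → V → Maybe C) → List V → Set
  AllJoined M D = ∀ {a b d} → a ∈ D → b ∈ D → d ∈ D → Joins M D a b d

  -- Partial colourings, since a single vertex is linked with no colours at all.
  Linked : ℕ → List V → Set
  Linked q D = ∃[ M ] (∀ u v → M u v ≡ M v u) × AllJoined {Fin q} M D

  -- Connecting two distinct vertices takes at least one edge. Its colour later serves as the
  -- default for uncoloured edges.
  Linked-colour : ∀ {q D a b} → Linked q D → a ∈ D → b ∈ D → a ≢ b → Fin q
  Linked-colour (M , _ , join) a∈ b∈ a≢b with join a∈ b∈ b∈
  ... | _ , c ∷ _ , _ = c
  ... | [] , [] , _ , _ , ε , _ = contradiction refl a≢b
  ... | [] , [] , _ , _ , inj₁ () ◅ _ , _
  ... | [] , [] , _ , _ , inj₂ () ◅ _ , _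

  -- The default colour may clash with others, but each joining edge has a `hue` in `M`, so the
  -- filling-in leaves the joining sets untouched.
  Linked⇒colouring : ∀ {q D} → Linked q D → (∀ v → v ∈ D) → Fin q → Has3RainbowColouring G q
  Linked⇒colouring {q} {D} (M , M-sym , join) all∈ default =
    matrix⇒colouring G (N , N-sym , (λ _ _ _ → _ , refl) , con)
    where
    open import Data.List.Membership.DecPropositional (ProductP.≡-dec (_≟_ {n}) (_≟_ {n}))
      using () renaming (_∈?_ to _∈E?_)

    N : V → V → Maybe (Fin q)
    N u v = just (Maybe.fromMaybe default (M u v))

    N-sym : ∀ u v → N u v ≡ N v u
    N-sym u v = cong (just ∘ Maybe.fromMaybe default) (M-sym u v)

    hue∈ : ∀ {L cs u v} → Pointwise (ColouredIn M D) L cs → (u , v) ∈ L → ∃[ c ] c ∈ cs × N u v ≡ just c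
    hue∈ (e ∷ _)  (here refl) = _ , here refl , cong (just ∘ Maybe.fromMaybe default) (ColouredIn.hue e)
    hue∈ (_ ∷ es) (there p)   = let c , c∈ , eq = hue∈ es p in c , there c∈ , eq

    hue-unique : ∀ {L cs u v x y} → Pointwise (ColouredIn M D) L cs → Unique cs → (u , v) ∈ L → (x , y) ∈ L →
      N u v ≡ N x y → (u , v) ≡ (x , y)
    hue-unique _        _          (here refl) (here refl) _  = refl
    hue-unique (_ ∷ es) (_ ∷ u)    (there p)   (there q)   eq = hue-unique es u p q eq
    hue-unique (e ∷ es) (new ∷ _)  (here refl) (there q)   eq with hue∈ (e ∷ []) (here refl) | hue∈ es q
    ... | _ , here refl , eq₁ | c , c∈ , eq₂ =
      contradiction (just-injective (trans (sym eq₁) (trans eq eq₂))) (All.lookup new c∈)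
    hue-unique (e ∷ es) (new ∷ _)  (there p) (here refl) eq with hue∈ (e ∷ []) (here refl) | hue∈ es p
    ... | _ , here refl , eq₁ | c , c∈ , eq₂ =
      contradiction (just-injective (trans (sym eq₁) (trans (sym eq) eq₂))) (All.lookup new c∈)

    edge∈ : ∀ {L cs u v} → Pointwise (ColouredIn M D) L cs → (u , v) ∈ L → u ~ v
    edge∈ (e ∷ _)  (here refl) = ColouredIn.is-edge e
    edge∈ (_ ∷ es) (there p)   = edge∈ es p

    con : ∀ S → ∣ S ∣ ≡ 3 → ∃ (Connects G N S)
    con S ∣S∣ with Subset-elements S
    ... | l , len , to , _ with l | trans len ∣S∣
    ... | a ∷ b ∷ d ∷ [] | _ with join (all∈ a) (all∈ b) (all∈ d)
    ... | L , cs , es , uniq , a-b , a-d = ρ , connects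
        (λ u v → ∨-comm (does ((u , v) ∈E? L)) _)
        (λ u v e → case ρ⁻ e of λ { (inj₁ p) → edge∈ es p ; (inj₂ p) → ~-sym (edge∈ es p) })
        rainbow
        (λ u v u∈ v∈ → Star.map (λ {u} {v} → ρ⁺ {u} {v}) (Conn-sym (from-a (to u∈)) ◅◅ from-a (to v∈)))
      where
      ρ : V → V → Bool
      ρ u v = does ((u , v) ∈E? L) ∨ does ((v , u) ∈E? L)

      ρ⁻ : ∀ {u v} → T (ρ u v) → (u , v) ∈ L ⊎ (v , u) ∈ L
      ρ⁻ {u} {v} e = Sum.map (T-does ((u , v) ∈E? L)) (T-does ((v , u) ∈E? L)) (T-∨⁻ (does ((u , v) ∈E? L)) e)

      ρ⁺ : ∀ {u v} → (u , v) ∈ L ⊎ (v , u) ∈ L → T (ρ u v)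
      ρ⁺ {u} {v} p = T-∨⁺ (does ((u , v) ∈E? L)) (Sum.map (does-T ((u , v) ∈E? L)) (does-T ((v , u) ∈E? L)) p)

      rainbow : ∀ u v x y → T (ρ u v) → T (ρ x y) → N u v ≡ N x y → (u ≡ x × v ≡ y) ⊎ (u ≡ y × v ≡ x)
      rainbow u v x y e e′ eq with ρ⁻ {u} {v} e | ρ⁻ {x} {y} e′
      ... | inj₁ p | inj₁ q with refl ← hue-unique es uniq p q eq = inj₁ (refl , refl)
      ... | inj₁ p | inj₂ q with refl ← hue-unique es uniq p q (trans eq (N-sym x y)) = inj₂ (refl , refl)
      ... | inj₂ p | inj₁ q with refl ← hue-unique es uniq p q (trans (N-sym v u) eq) = inj₂ (refl , refl)
      ... | inj₂ p | inj₂ q with refl ← hue-unique es uniq p q (trans (N-sym v u) (trans eq (N-sym x y))) =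
        inj₁ (refl , refl)

      from-a : ∀ {v} → v ∈ a ∷ b ∷ d ∷ [] → Conn L a v
      from-a (here refl)                 = ε
      from-a (there (here refl))         = a-b
      from-a (there (there (here refl))) = a-d

  Linked-point : ∀ a → Linked 0 [ a ]
  Linked-point a = (λ _ _ → nothing) , (λ _ _ → refl) ,
    λ { (here refl) (here refl) (here refl) → [] , [] , [] , [] , ε , ε }

  -- The `p` new colours take the low indices and the old ones are shifted past them, so a rainbow
  -- set of new edges never clashes with an old one.
  module Extension {p q : ℕ} {D D′ : List V} {M : V → V → Maybe (Fin q)} (M′ : V → V → Maybe (Fin (p ℕ.+ q)))
    (D⊆D′ : ∀ {v} → v ∈ D → v ∈ D′)
    (agrees : ∀ {u v} → u ∈ D → v ∈ D → M′ u v ≡ Maybe.map (p ↑ʳ_) (M u v))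
    (join : AllJoined M D) where

    New : V × V → Fin p → Set
    New e l = ColouredIn M′ D′ e (l ↑ˡ q)

    -- The new edges carry the three vertices into `D`, and the old linkage joins the points where
    -- they arrive.
    attach : ∀ {L ls a b d a′ b′ d′} → Pointwise New L ls → Unique ls →
      a′ ∈ D → b′ ∈ D → d′ ∈ D → Conn L a a′ → Conn L b b′ → Conn L d d′ → Joins M′ D′ a b d
    attach {L} {ls} es uniq a′∈ b′∈ d′∈ a-a′ b-b′ d-d′ with join a′∈ b′∈ d′∈
    ... | L₀ , cs , es₀ , uniq₀ , a-b , a-d =
      L ++ L₀ , map (_↑ˡ q) ls ++ map (p ↑ʳ_) cs ,
      Pointwise.++⁺ (new es) (old es₀) ,
      Unique-++ (Unique.map⁺ (↑ˡ-injective q _ _) uniq) (Unique.map⁺ (↑ʳ-injective p _ _) uniq₀) disjoint ,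
      (inL a-a′ ◅◅ inL₀ a-b ◅◅ Conn-sym (inL b-b′)) ,
      (inL a-a′ ◅◅ inL₀ a-d ◅◅ Conn-sym (inL d-d′))
      where
      inL : ∀ {u v} → Conn L u v → Conn (L ++ L₀) u v
      inL = Conn-⊆ ∈-++⁺ˡ
      inL₀ : ∀ {u v} → Conn L₀ u v → Conn (L ++ L₀) u v
      inL₀ = Conn-⊆ (∈-++⁺ʳ L)
      new : ∀ {L ls} → Pointwise New L ls → Pointwise (ColouredIn M′ D′) L (map (_↑ˡ q) ls)
      new []       = []
      new (e ∷ es) = e ∷ new es
      old : ∀ {L cs} → Pointwise (ColouredIn M D) L cs → Pointwise (ColouredIn M′ D′) L (map (p ↑ʳ_) cs)
      old [] = []
      old (coloured e s∈ e∈ h ∷ es) =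
        coloured e (D⊆D′ s∈) (D⊆D′ e∈) (trans (agrees s∈ e∈) (cong (Maybe.map (p ↑ʳ_)) h)) ∷ old es
      disjoint : ∀ {x} → x ∈ map (_↑ˡ q) ls → x ∉ map (p ↑ʳ_) cs
      disjoint x∈ x∈′ with ∈-map⁻ (_↑ˡ q) x∈ | ∈-map⁻ (p ↑ʳ_) x∈′
      ... | l , _ , refl | c , _ , eq = case trans (sym (FinP.splitAt-↑ˡ p l q))
        (trans (cong (Fin.splitAt p) eq) (FinP.splitAt-↑ʳ p q c)) of λ ()

    -- `ls` is a budget of labels rather than the list of those used: a vertex of `D`, which needs
    -- no edge, has a way within every budget.
    record Way (a : V) (ls : List (Fin p)) : Set where
      constructor way
      field
        {exit}   : V
        {route}  : List (V × V)
        {labels} : List (Fin p)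
        exit∈    : exit ∈ D
        edges    : Pointwise New route labels
        distinct : Unique labels
        labels⊆  : ∀ {l} → l ∈ labels → l ∈ ls
        leads    : Conn route a exit

    stay : ∀ {a ls} → a ∈ D → Way a ls
    stay a∈ = way a∈ [] [] (λ ()) ε

    one : ∀ {a r l} → New (a , r) l → r ∈ D → ∀ {ls} → l ∈ ls → Way a ls
    one e r∈ l∈ = way r∈ (e ∷ []) ([] ∷ []) (λ { (here refl) → l∈ }) Conn-here

    two : ∀ {a w r l m} → New (a , w) l → New (w , r) m → l ≢ m → r ∈ D → Way a (l ∷ m ∷ [])
    two e e′ l≢m r∈ = way r∈ (e ∷ e′ ∷ []) ((l≢m ∷ []) ∷ [] ∷ []) id
      (inj₁ (here refl) ◅ inj₁ (there (here refl)) ◅ ε)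

    -- For concrete budgets `True (apart? ls ms)` computes to the unit type, so disjointness is
    -- checked silently at every call.
    combine : ∀ {a b d ls ms ns} {_ : True (apart? ls ms)} {_ : True (apart? ls ns)} {_ : True (apart? ms ns)} →
      Way a ls → Way b ms → Way d ns → Joins M′ D′ a b d
    combine {ls = ls} {ms} {ns} {lm} {ln} {mn}
      (way {route = R₁} x∈ es₁ u₁ s₁ c₁) (way {route = R₂} {ls₂} y∈ es₂ u₂ s₂ c₂) (way z∈ es₃ u₃ s₃ c₃) =
      attach (Pointwise.++⁺ es₁ (Pointwise.++⁺ es₂ es₃))
        (Unique-++ u₁ (Unique-++ u₂ u₃ (λ p q → apart mn (s₂ p) (s₃ q)))
          (λ p q → [ apart lm (s₁ p) ∘ s₂ , apart ln (s₁ p) ∘ s₃ ]′ (∈-++⁻ ls₂ q)))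
        x∈ y∈ z∈ (Conn-⊆ ∈-++⁺ˡ c₁)
        (Conn-⊆ (∈-++⁺ʳ R₁ ∘ ∈-++⁺ˡ) c₂)
        (Conn-⊆ (∈-++⁺ʳ R₁ ∘ ∈-++⁺ʳ R₂) c₃)
      where
      apart : ∀ {ls ms l} → True (apart? ls ms) → l ∈ ls → l ∉ ms
      apart t p q = All.lookup (All.lookup (toWitness t) p) q refl

  -- Linking a clique

  Clique : List V → Set
  Clique = AllPairs _~_

  Joins-swapˡ : ∀ {C : Set} {M : V → V → Maybe C} {D a b d} → Joins M D a b d → Joins M D b a d
  Joins-swapˡ (L , cs , es , u , a-b , a-d) = L , cs , es , u , Conn-sym a-b , Conn-sym a-b ◅◅ a-d

  Joins-swapʳ : ∀ {C : Set} {M : V → V → Maybe C} {D a b d} → Joins M D a b d → Joins M D a d b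
  Joins-swapʳ (L , cs , es , u , a-b , a-d) = L , cs , es , u , a-d , a-b

  Linked-resp : ∀ {q D D′} → (∀ {v} → v ∈ D → v ∈ D′) → (∀ {v} → v ∈ D′ → v ∈ D) → Linked q D → Linked q D′
  Linked-resp to from (M , s , join) = M , s , λ a∈ b∈ d∈ →
    let L , cs , es , rest = join (from a∈) (from b∈) (from d∈)
    in L , cs , Pointwise.map (λ (coloured e s∈ e∈ h) → coloured e (to s∈) (to e∈) h) es , rest

  Linked-leaf : ∀ {q D p x} → Linked q D → p ∈ D → x ∉ D → p ~ x → Linked (suc q) (x ∷ D)
  Linked-leaf {q} {D} {p} {x} (M , M-sym , join) p∈ x∉ p~x = M′ , M′-sym , join′
    where
    M′ : V → V → Maybe (Fin (suc q))
    M′ u v = if joins p x u v then just zero else Maybe.map suc (M u v)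

    M′-sym : ∀ u v → M′ u v ≡ M′ v u
    M′-sym u v = cong₂ (λ b c → if b then just zero else Maybe.map suc c) (joins-sym p x u v) (M-sym u v)

    agrees : ∀ {u v} → u ∈ D → v ∈ D → M′ u v ≡ Maybe.map suc (M u v)
    agrees {u} {v} u∈ v∈ with joins p x u v in eq
    ... | false = refl
    ... | true with joins⁻ {p = p} {x} {u} {v} (Equivalence.from T-≡ eq)
    ...   | inj₁ (_ , refl) = contradiction v∈ x∉
    ...   | inj₂ (refl , _) = contradiction u∈ x∉

    open Extension {p = 1} M′ there agrees join

    retract : ∀ {v} → v ∈ x ∷ D → ∃[ w ] w ∈ D × Conn [ (p , x) ] v w
    retract (here refl) = p , p∈ , Conn-sym Conn-here
    retract (there v∈)  = _ , v∈ , ε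

    new : New (p , x) zero
    new = coloured p~x (there p∈) (here refl)
      (cong (λ b → if b then just zero else Maybe.map suc (M p x)) (Equivalence.to T-≡ (joins-refl p x)))

    join′ : AllJoined M′ (x ∷ D)
    join′ a∈ b∈ d∈ with retract a∈ | retract b∈ | retract d∈
    ... | _ , a′∈ , ca | _ , b′∈ , cb | _ , d′∈ , cd =
      -- The pendant edge is taken even if `x` is not among the three vertices: its colour is new,
      -- hence harmless, and one case covers all triples.
      attach (new ∷ []) ([] ∷ []) a′∈ b′∈ d′∈ ca cb cd

  -- A triangle without a single common colour has two differently coloured edges; these share a
  -- vertex and so join all three.
  Linked-clique-≤5 : ∀ {K} → Clique K → length K ℕ.≤ 5 → Linked 2 K
  Linked-clique-≤5 {K} clique ≤5 = M , M-sym , join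
    where
    position : V → Fin 5
    position v with v ∈? K
    ... | yes v∈ = inject≤ (Any.index v∈) ≤5
    ... | no _   = zero

    position-injective : ∀ {u v} → u ∈ K → v ∈ K → position u ≡ position v → u ≡ v
    position-injective {u} {v} u∈ v∈ eq with u ∈? K | v ∈? K
    ... | no u∉ | _     = contradiction u∈ u∉
    ... | yes _ | no v∉ = contradiction v∈ v∉
    ... | yes p | yes q = trans (AnyP.lookup-index p)
      (trans (cong (lookup K) (inject≤-injective ≤5 ≤5 _ _ eq)) (sym (AnyP.lookup-index q)))

    M : V → V → Maybe (Fin 2)
    M u v = just (pentagon (position u) (position v))

    M-sym : ∀ u v → M u v ≡ M v u
    M-sym u v = cong (λ b → just (if b then zero else suc zero)) (Graph.adj-sym C₅ (position u) (position v))

    edge : ∀ {u v} → u ∈ K → v ∈ K → u ≢ v → ColouredIn M K (u , v) (pentagon (position u) (position v))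
    edge u∈ v∈ u≢v = coloured (AllPairs-lookup ~-sym clique u∈ v∈ u≢v) u∈ v∈ refl

    pair : ∀ {a b} → a ∈ K → b ∈ K → Joins M K a a b
    pair {a} {b} a∈ b∈ with a ≟ b
    ... | yes refl = [] , [] , [] , [] , ε , ε
    ... | no a≢b   = _ , _ , edge a∈ b∈ a≢b ∷ [] , [] ∷ [] , ε , Conn-here

    join : AllJoined M K
    join {a} {b} {d} a∈ b∈ d∈ with a ≟ b | a ≟ d | b ≟ d
    ... | yes refl | _        | _        = pair a∈ d∈
    ... | no _     | yes refl | _        = Joins-swapʳ (pair a∈ b∈)
    ... | no _     | no _     | yes refl = Joins-swapˡ (Joins-swapʳ (pair b∈ a∈))
    ... | no a≢b   | no a≢d   | no b≢d
      with pentagon-no-mono (position a) (position b) (position d)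
        (a≢b ∘ position-injective a∈ b∈) (a≢d ∘ position-injective a∈ d∈) (b≢d ∘ position-injective b∈ d∈)
    ...   | inj₁ ab≢bd = _ , _ , edge a∈ b∈ a≢b ∷ edge b∈ d∈ b≢d ∷ [] , (ab≢bd ∷ []) ∷ [] ∷ [] ,
      Conn-here , inj₁ (here refl) ◅ inj₁ (there (here refl)) ◅ ε
    ...   | inj₂ ab≢ad = _ , _ , edge a∈ b∈ a≢b ∷ edge a∈ d∈ a≢d ∷ [] , (ab≢ad ∷ []) ∷ [] ∷ [] ,
      Conn-here , inj₁ (there (here refl)) ◅ ε

  -- Colour 0 leads from R to d₁ and colour 1 to d₂; when all three vertices lie
  -- in R, one of them first moves to another by colour 2.
  Linked-clique-extension : ∀ {q D d₁ d₂ R} → Linked q D → d₁ ∈ D → d₂ ∈ D → d₁ ≢ d₂ →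
    (∀ {x} → x ∈ R → x ∉ D × x ~ d₁ × x ~ d₂) → Clique R → Linked (3 ℕ.+ q) (R ++ D)
  Linked-clique-extension {q} {D} {d₁} {d₂} {R} (M , M-sym , join) d₁∈ d₂∈ d₁≢d₂ R-prop clique =
    M′ , M′-sym , join′
    where
    toll : V → Maybe (Fin (3 ℕ.+ q))
    toll d = if does (d ≟ d₁) then just 0F else just 1F

    entry : ∀ u v → Dec (u ∈ D) → Dec (v ∈ D) → Maybe (Fin (3 ℕ.+ q))
    entry u v (yes _) (yes _) = Maybe.map (3 ↑ʳ_) (M u v)
    entry u v (yes _) (no _)  = toll u
    entry u v (no _)  (yes _) = toll v
    entry u v (no _)  (no _)  = just 2F

    M′ : V → V → Maybe (Fin (3 ℕ.+ q))
    M′ u v = entry u v (u ∈? D) (v ∈? D)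

    M′-sym : ∀ u v → M′ u v ≡ M′ v u
    M′-sym u v with u ∈? D | v ∈? D
    ... | yes _ | yes _ = cong (Maybe.map (3 ↑ʳ_)) (M-sym u v)
    ... | yes _ | no _  = refl
    ... | no _  | yes _ = refl
    ... | no _  | no _  = refl

    agrees : ∀ {u v} → u ∈ D → v ∈ D → M′ u v ≡ Maybe.map (3 ↑ʳ_) (M u v)
    agrees {u} {v} u∈ v∈ with u ∈? D | v ∈? D
    ... | yes _ | yes _ = refl
    ... | yes _ | no v∉ = contradiction v∈ v∉
    ... | no u∉ | _     = contradiction u∈ u∉

    open Extension {p = 3} {D′ = R ++ D} M′ (∈-++⁺ʳ R) agrees join

    outer : ∀ {x d} → x ∉ D → d ∈ D → M′ x d ≡ toll d
    outer {x} {d} x∉ d∈ with x ∈? D | d ∈? D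
    ... | yes x∈ | _     = contradiction x∈ x∉
    ... | no _   | no d∉ = contradiction d∈ d∉
    ... | no _   | yes _ = refl

    new₀ : ∀ {x} → x ∈ R → New (x , d₁) 0F
    new₀ x∈ = let x∉ , x~ , _ = R-prop x∈ in coloured x~ (∈-++⁺ˡ x∈) (∈-++⁺ʳ R d₁∈)
      (trans (outer x∉ d₁∈) (cong (λ b → if b then just 0F else just 1F) (dec-true (d₁ ≟ d₁) refl)))

    new₁ : ∀ {x} → x ∈ R → New (x , d₂) 1F
    new₁ x∈ = let x∉ , _ , x~ = R-prop x∈ in coloured x~ (∈-++⁺ˡ x∈) (∈-++⁺ʳ R d₂∈)
      (trans (outer x∉ d₂∈) (cong (λ b → if b then just 0F else just 1F) (dec-false (d₂ ≟ d₁) (≢-sym d₁≢d₂))))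

    new₂ : ∀ {x y} → x ∈ R → y ∈ R → x ≢ y → New (x , y) 2F
    new₂ {x} {y} x∈ y∈ x≢y = coloured (AllPairs-lookup ~-sym clique x∈ y∈ x≢y) (∈-++⁺ˡ x∈) (∈-++⁺ˡ y∈) hue
      where
      hue : M′ x y ≡ just 2F
      hue with x ∈? D | y ∈? D
      ... | yes p | _     = contradiction p (proj₁ (R-prop x∈))
      ... | no _  | yes p = contradiction p (proj₁ (R-prop y∈))
      ... | no _  | no _  = refl

    way₀ : ∀ {x} → x ∈ R → Way x [ 0F ]
    way₀ x∈ = one (new₀ x∈) d₁∈ (here refl)

    way₁ : ∀ {x} → x ∈ R → Way x [ 1F ]
    way₁ x∈ = one (new₁ x∈) d₂∈ (here refl)

    at : ∀ {x} → x ∈ D → Way x []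
    at = stay

    join-R : ∀ {a b d} → a ∈ R → b ∈ R → d ∈ R → Joins M′ (R ++ D) a b d
    join-R {a} {b} a∈ b∈ d∈ with a ≟ b
    -- Only two vertices are left to join; `d₁` fills the third slot.
    ... | yes refl = let L , cs , es , u , a-d , _ = combine (way₀ a∈) (way₁ d∈) (at d₁∈)
                     in L , cs , es , u , ε , a-d
    -- `b` moves to `a`, `a` leaves by 0 and `d` by 1. The set stays rainbow if `d` is `a` or `b`.
    ... | no a≢b = attach (new₂ b∈ a∈ (≢-sym a≢b) ∷ new₀ a∈ ∷ new₁ d∈ ∷ [])
      (((λ ()) ∷ (λ ()) ∷ []) ∷ ((λ ()) ∷ []) ∷ [] ∷ []) d₁∈ d₁∈ d₂∈
      (inj₁ (there (here refl)) ◅ ε)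
      (inj₁ (here refl) ◅ inj₁ (there (here refl)) ◅ ε)
      (inj₁ (there (there (here refl))) ◅ ε)

    join′ : AllJoined M′ (R ++ D)
    join′ a∈ b∈ d∈ with ∈-++⁻ R a∈ | ∈-++⁻ R b∈ | ∈-++⁻ R d∈
    ... | inj₁ a | inj₁ b | inj₁ d = join-R a b d
    ... | inj₁ a | inj₁ b | inj₂ d = combine (way₀ a) (way₁ b) (at d)
    ... | inj₁ a | inj₂ b | inj₁ d = combine (way₀ a) (at b) (way₁ d)
    ... | inj₂ a | inj₁ b | inj₁ d = combine (at a) (way₀ b) (way₁ d)
    ... | inj₁ a | inj₂ b | inj₂ d = combine (way₀ a) (at b) (at d)
    ... | inj₂ a | inj₁ b | inj₂ d = combine (at a) (way₀ b) (at d)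
    ... | inj₂ a | inj₂ b | inj₁ d = combine (at a) (at b) (way₀ d)
    ... | inj₂ a | inj₂ b | inj₂ d = combine (at a) (at b) (at d)

  -- Four colours fit the bound from order 6 on, which is where R(3,3) = 6 makes two colours
  -- insufficient. Below that, a single vertex takes none and orders 2 to 5 take the two pentagon
  -- colours.
  Linked-clique : ∀ {K v} → v ∈ K → Clique K → ∃[ q ] 2 ℕ.* q ℕ.≤ 2 ℕ.+ length K × Linked q K
  Linked-clique {a ∷ []} _ _ = 0 , z≤n , Linked-point a
  Linked-clique {K@(d₁ ∷ d₂ ∷ R)} _ clique@((e ∷ e₁) ∷ e₂ ∷ es) with length K ℕ.≤? 5
  ... | yes ≤5 = 2 , s≤s (s≤s (s≤s (s≤s z≤n))) , Linked-clique-≤5 clique ≤5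
  -- One colour for the edge between `d₁` and `d₂`, three for attaching the remaining clique to it.
  ... | no ≰5  = 4 , s≤s (s≤s (ℕP.≰⇒> ≰5)) , Linked-resp to from
    (Linked-clique-extension (Linked-leaf (Linked-point d₁) (here refl) (λ { (here eq) → ~⇒≢ e (sym eq) }) e)
      (there (here refl)) (here refl) (~⇒≢ e) prop es)
    where
    prop : ∀ {x} → x ∈ R → x ∉ d₂ ∷ d₁ ∷ [] × x ~ d₁ × x ~ d₂
    prop x∈ = let x₁ = All.lookup e₁ x∈ ; x₂ = All.lookup e₂ x∈ in
      (λ { (here eq) → ~⇒≢ x₂ (sym eq) ; (there (here eq)) → ~⇒≢ x₁ (sym eq) }) , ~-sym x₁ , ~-sym x₂
    to : ∀ {v} → v ∈ R ++ d₂ ∷ d₁ ∷ [] → v ∈ d₁ ∷ d₂ ∷ R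
    to v∈ with ∈-++⁻ R v∈
    ... | inj₁ v∈R              = there (there v∈R)
    ... | inj₂ (here eq)         = there (here eq)
    ... | inj₂ (there (here eq)) = here eq
    from : ∀ {v} → v ∈ d₁ ∷ d₂ ∷ R → v ∈ R ++ d₂ ∷ d₁ ∷ []
    from (here eq)         = ∈-++⁺ʳ R (there (here eq))
    from (there (here eq)) = ∈-++⁺ʳ R (here eq)
    from (there (there v∈)) = ∈-++⁺ˡ v∈

  -- The dominating clique

  Dominates : List V → Fin n → Set
  Dominates K v = v ∈ K ⊎ ∃[ k ] k ∈ K × v ~ k

  dominates? : ∀ K v → Dec (Dominates K v)
  dominates? K v = (v ∈? K) ⊎-dec any? (λ k → (k ∈? K) ×-dec T? (adj G v k))

  -- The adjacency of `v` and `x` is the only one left open: a non-edge completes an induced path,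
  -- an edge an induced 5-cycle.
  no-induced-walk : P₅C₅-Free G → ∀ {v w a k x} → v ~ w → w ~ a → a ~ k → k ~ x →
    ¬ v ~ a → ¬ v ~ k → ¬ w ~ k → ¬ w ~ x → ¬ a ~ x → ⊥
  no-induced-walk (noP₅ , noC₅) {v} {w} {a} {k} {x} vw wa ak kx va vk wk wx ax with adj G v x in vx
  ... | false = noP₅ (induced {H = P₅} {G} (from-yes (twinFree? P₅)) f
    (upper-pairs {R = λ i j → adj G (f i) (f j) ≡ adj P₅ i j}
      (edge vw) (¬T⇒≡false va) (¬T⇒≡false vk) vx (edge wa) (¬T⇒≡false wk) (¬T⇒≡false wx)
      (edge ak) (¬T⇒≡false ax) (edge kx)))
    where
    f : Fin 5 → Fin n
    f = lookup (v ∷ w ∷ a ∷ k ∷ x ∷ [])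
    edge : ∀ {b} → T b → b ≡ true
    edge = Equivalence.to T-≡
  ... | true = noC₅ (induced {H = C₅} {G} (from-yes (twinFree? C₅)) f
    (upper-pairs {R = λ i j → adj G (f i) (f j) ≡ adj C₅ i j}
      (edge vw) (¬T⇒≡false va) (¬T⇒≡false vk) vx (edge wa) (¬T⇒≡false wk) (¬T⇒≡false wx)
      (edge ak) (¬T⇒≡false ax) (edge kx)))
    where
    f : Fin 5 → Fin n
    f = lookup (v ∷ w ∷ a ∷ k ∷ x ∷ [])
    edge : ∀ {b} → T b → b ≡ true
    edge = Equivalence.to T-≡

  -- When v is not dominated by the clique K but has a neighbour w in the
  -- dominated part, w together with N(w) ∩ K takes over: a vertex x missed by it
  -- would give an induced path or cycle v, w, a, k, x with a, k in K.
  dominating-clique : Connected G → P₅C₅-Free G → ∃[ K ] Clique K × ∀ v → Dominates K v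
  dominating-clique ((a , _) , conn) free
    with grow (adj G) (λ l → ∃[ K ] Clique K × (∀ {v} → v ∈ l → Dominates K v)) a base step
    where
    base : ∃[ K ] Clique K × (∀ {v} → v ∈ [ a ] → Dominates K v)
    base = [ a ] , [] ∷ [] , inj₁
    step : ∀ {l w v} → w ∈ l → v ∉ l → w ~ v → ∃[ K ] Clique K × (∀ {v} → v ∈ l → Dominates K v) →
      ∃[ K ] Clique K × (∀ {u} → u ∈ v ∷ l → Dominates K u)
    step {l} {w} {v} w∈ _ w~v (K , clique , dom) with dominates? K v
    ... | yes dom-v = K , clique , λ { (here refl) → dom-v ; (there u∈) → dom u∈ }
    ... | no undom with dom w∈
    ...   | inj₁ w∈K = contradiction (inj₂ (w , w∈K , ~-sym w~v)) undom
    ...   | inj₂ (a , a∈K , w~a) = w ∷ N , AllP.all-filter w~? K ∷ AllPairsP.filter⁺ w~? clique , dom′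
      where
      w~? : Decidable (w ~_)
      w~? u = T? (adj G w u)
      N : List V
      N = filter w~? K
      v≁K : ∀ {k} → k ∈ K → ¬ v ~ k
      v≁K k∈ e = undom (inj₂ (_ , k∈ , e))
      dom′ : ∀ {x} → x ∈ v ∷ l → Dominates (w ∷ N) x
      dom′ (here refl) = inj₂ (w , here refl , ~-sym w~v)
      dom′ {x} (there x∈) with dominates? (w ∷ N) x
      ... | yes dom-x = dom-x
      ... | no missed = ⊥-elim (absurd (dom x∈))
        where
        x≁N : ∀ {k} → k ∈ K → w ~ k → ¬ x ~ k
        x≁N k∈ w~k e = missed (inj₂ (_ , there (∈-filter⁺ w~? k∈ w~k) , e))
        absurd : ¬ Dominates K x
        -- A member of `K` is `a` or adjacent to `a`, which lies in `N`. So a missed `x` is outside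
        -- `K`, and its neighbour `k` in `K` cannot belong to `N`.
        absurd (inj₁ x∈K) with x ≟ a
        ... | yes refl = missed (inj₁ (there (∈-filter⁺ w~? a∈K w~a)))
        ... | no x≢a   = x≁N a∈K w~a (AllPairs-lookup ~-sym clique x∈K a∈K x≢a)
        absurd (inj₂ (k , k∈K , x~k)) = no-induced-walk free (~-sym w~v) w~a
          (AllPairs-lookup ~-sym clique a∈K k∈K (λ { refl → w≁k w~a })) (~-sym x~k)
          (v≁K a∈K) (v≁K k∈K) w≁k (λ w~x → missed (inj₂ (w , here refl , ~-sym w~x)))
          (x≁N a∈K w~a ∘ ~-sym)
          where
          w≁k : ¬ w ~ k
          w≁k w~k = x≁N k∈K w~k x~k
  ... | l , (K , clique , dom) , _ , a∈ , cl =
    K , clique , λ v → dom (Closed-Star {ρ = adj G} cl a∈ (conn SubsetP.∈⊤ SubsetP.∈⊤))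

  -- Independent sets and domination by half of the vertices

  maximal-independent : ∀ S → ∃[ I ] (∀ {u v} → u ∈ I → v ∈ I → ¬ u ~ v) × (∀ {u} → u ∈ I → u ∈ S) ×
    (∀ {v} → v ∈ S → Dominates I v)
  maximal-independent [] = [] , (λ ()) , (λ ()) , (λ ())
  maximal-independent (s ∷ S) with maximal-independent S
  ... | I , indep , I⊆S , dom with dominates? I s
  ...   | yes dom-s = I , indep , there ∘ I⊆S , λ { (here refl) → dom-s ; (there v∈) → dom v∈ }
  ...   | no undom = s ∷ I , indep′ , (λ { (here refl) → here refl ; (there u∈) → there (I⊆S u∈) }) ,
    λ { (here refl) → inj₁ (here refl) ; (there v∈) → Sum.map there (λ (k , k∈ , e) → k , there k∈ , e) (dom v∈) }
    where
    indep′ : ∀ {u v} → u ∈ s ∷ I → v ∈ s ∷ I → ¬ u ~ v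
    indep′ (here refl) (here refl) e = ~⇒≢ e refl
    indep′ (here refl) (there v∈)  e = undom (inj₂ (_ , v∈ , e))
    indep′ (there u∈)  (here refl) e = undom (inj₂ (_ , u∈ , ~-sym e))
    indep′ (there u∈)  (there v∈)  e = indep u∈ v∈ e

  record HalfDominating (S X : List V) : Set where
    field
      unique : Unique X
      half   : 2 ℕ.* length X ℕ.≤ length S
      inside : ∀ {x} → x ∈ X → x ∈ S
      covers : ∀ {v} → v ∈ S → v ∉ X → (∃[ x ] x ∈ X × v ~ x) ⊎ (∀ {s} → s ∈ S → ¬ v ~ s)

  -- A maximal independent set and its complement both dominate the
  -- non-isolated vertices; take the smaller one.
  half-domination : ∀ S → Unique S → ∃ (HalfDominating S)
  half-domination S uniq with maximal-independent S
  ... | I , indep , I⊆S , dom = choose (ℕP.≤-total (length A) (length B))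
    where
    ∉I? : Decidable (_∉ I)
    ∉I? v = ¬? (v ∈? I)

    A B : List V
    A = filter (_∈? I) S
    B = filter ∉I? S

    split : ∀ S → length (filter (_∈? I) S) ℕ.+ length (filter ∉I? S) ≡ length S
    split [] = refl
    split (s ∷ S) with s ∈? I
    ... | yes _ = cong suc (split S)
    ... | no _  = trans (ℕP.+-suc _ _) (cong suc (split S))

    half : ∀ {a b} → a ℕ.≤ b → a ℕ.+ b ≡ length S → 2 ℕ.* a ℕ.≤ length S
    half {a} {b} a≤b eq = ℕP.≤-trans (ℕP.≤-reflexive (cong (a ℕ.+_) (ℕP.+-identityʳ a)))
      (ℕP.≤-trans (ℕP.+-monoʳ-≤ a a≤b) (ℕP.≤-reflexive eq))

    choose : length A ℕ.≤ length B ⊎ length B ℕ.≤ length A → ∃ (HalfDominating S)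
    choose (inj₁ A≤B) = A , record
      { unique = Unique.filter⁺ (_∈? I) uniq ; half = half A≤B (split S)
      ; inside = λ x∈ → proj₁ (∈-filter⁻ (_∈? I) x∈) ; covers = via-A }
      where
      via-A : ∀ {v} → v ∈ S → v ∉ A → (∃[ x ] x ∈ A × v ~ x) ⊎ (∀ {s} → s ∈ S → ¬ v ~ s)
      via-A v∈ v∉A with dom v∈
      ... | inj₁ v∈I           = contradiction (∈-filter⁺ (_∈? I) v∈ v∈I) v∉A
      ... | inj₂ (x , x∈ , e) = inj₁ (x , ∈-filter⁺ (_∈? I) (I⊆S x∈) x∈ , e)
    choose (inj₂ B≤A) = B , record
      { unique = Unique.filter⁺ ∉I? uniq ; half = half B≤A (trans (ℕP.+-comm (length B) _) (split S))
      ; inside = λ x∈ → proj₁ (∈-filter⁻ ∉I? x∈) ; covers = via-B }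
      where
      via-B : ∀ {v} → v ∈ S → v ∉ B → (∃[ x ] x ∈ B × v ~ x) ⊎ (∀ {s} → s ∈ S → ¬ v ~ s)
      via-B {v} v∈ v∉B with any? (λ s → (s ∈? S) ×-dec T? (adj G v s))
      ... | no isolated = inj₂ (λ s∈ e → isolated (_ , s∈ , e))
      ... | yes (s , s∈ , e) = inj₁ (s , ∈-filter⁺ ∉I? s∈ s∉I , e)
        where
        v∈I : v ∈ I
        v∈I = decidable-stable (v ∈? I) (λ v∉I → v∉B (∈-filter⁺ ∉I? v∈ v∉I))
        s∉I : s ∉ I
        s∉I s∈I = indep v∈I s∈I e

  -- Four more colours for vertices with two neighbours in a linked set

  avoiding-neighbour : δ G ≥ 3 → ∀ v a b → ∃[ c ] v ~ c × c ≢ a × c ≢ b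
  avoiding-neighbour δ≥3 v a b with any? (λ c → T? (adj G v c) ×-dec (¬? (c ≟ a) ×-dec ¬? (c ≟ b)))
  ... | yes found = found
  -- Otherwise all neighbours of `v` lie among `a` and `b`, which bounds its degree by 2.
  ... | no none = contradiction (ℕP.≤-trans deg≥3 deg≤2) λ { (s≤s (s≤s ())) }
    where
    deg≥3 : 3 ℕ.≤ degree G v
    deg≥3 = ℕP.≤-trans δ≥3
      (All.lookup (Extrema.min≤xs n (map (degree G) (allFin n))) (∈-map⁺ (degree G) (∈-allFin v)))

    N⊆ : tabulate (adj G v) ⊆ˢ ⁅ a ⁆ ∪ ⁅ b ⁆
    N⊆ {c} c∈ with c ≟ a | c ≟ b
    ... | yes refl | _        = x∈p∪q⁺ (inj₁ (x∈⁅x⁆ a))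
    ... | no _     | yes refl = x∈p∪q⁺ (inj₂ (x∈⁅x⁆ b))
    ... | no c≢a   | no c≢b   = contradiction (c , Equivalence.from T-≡ v~c , c≢a , c≢b) none
      where
      v~c : adj G v c ≡ true
      v~c = trans (sym (VecP.lookup∘tabulate (adj G v) c)) (VecP.[]=⇒lookup c∈)

    deg≤2 : degree G v ℕ.≤ 2
    deg≤2 = ℕP.≤-trans (p⊆q⇒∣p∣≤∣q∣ N⊆) (ℕP.≤-trans (∣p∪q∣≤∣p∣+∣q∣ ⁅ a ⁆ ⁅ b ⁆)
      (ℕP.≤-reflexive (cong₂ ℕ._+_ (∣⁅x⁆∣≡1 a) (∣⁅x⁆∣≡1 b))))

  -- The vertices outside D are split into a maximal independent set U and its
  -- complement. A vertex of U reaches D by edges labelled 0 and 1, and by a third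
  -- edge labelled 2 or a crossing edge 3 followed by 2; for the other vertices the
  -- labels 0 and 2 are exchanged. So any three vertices leave by disjoint labels.
  Linked-two-dominated : ∀ {q D} → δ G ≥ 3 → Linked q D →
    (∀ v → v ∈ D ⊎ ∃₂ λ d e → d ∈ D × e ∈ D × d ≢ e × v ~ d × v ~ e) → Linked (4 ℕ.+ q) (allFin n)
  Linked-two-dominated {q} {D} δ≥3 (M , M-sym , join) ports
    with maximal-independent (filter (λ v → ¬? (v ∈? D)) (allFin n))
  ... | U , indep , U⊆ , dom = M′ , M′-sym , λ {a} {b} {d} _ _ _ → join′ (exits a) (exits b) (exits d)
    where
    data Role (v : V) : Set where
      core  : v ∈ D → Role v
      left  : v ∉ D → v ∈ U → Role v
      right : v ∉ D → v ∉ U → Role v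

    role : ∀ v → Role v
    role v with v ∈? D | v ∈? U
    ... | yes v∈ | _       = core v∈
    ... | no v∉  | yes v∈U = left v∉ v∈U
    ... | no v∉  | no v∉U  = right v∉ v∉U

    -- The default `v` arises only for `v` in `D`, where no port is consulted.
    port₁ port₂ : V → V
    port₁ v = [ (λ _ → v) , proj₁ ]′ (ports v)
    port₂ v = [ (λ _ → v) , proj₁ ∘ proj₂ ]′ (ports v)

    port-props : ∀ {v} → v ∉ D → port₁ v ∈ D × port₂ v ∈ D × port₁ v ≢ port₂ v × v ~ port₁ v × v ~ port₂ v
    port-props {v} v∉ with ports v
    ... | inj₁ v∈              = contradiction v∈ v∉
    ... | inj₂ (_ , _ , props) = props

    -- Every edge from `v` to a non-port of `D` gets the third label, so any third neighbour in `D`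
    -- gives the same exit.
    toll : Fin 4 → Fin 4 → Fin 4 → V → V → Fin 4
    toll i j k v d = if does (d ≟ port₁ v) then i else if does (d ≟ port₂ v) then j else k

    toll₁ : ∀ {i j k} v → toll i j k v (port₁ v) ≡ i
    toll₁ {i} {j} {k} v = cong (λ b → if b then i else if does (port₁ v ≟ port₂ v) then j else k)
      (dec-true (port₁ v ≟ port₁ v) refl)

    toll₂ : ∀ {i j k v} → v ∉ D → toll i j k v (port₂ v) ≡ j
    toll₂ {i} {j} {k} {v} v∉ = let _ , _ , ne , _ = port-props v∉ in
      cong₂ (λ b c → if b then i else if c then j else k)
      (dec-false (port₂ v ≟ port₁ v) (≢-sym ne)) (dec-true (port₂ v ≟ port₂ v) refl)

    toll₃ : ∀ {i j k v d} → d ≢ port₁ v → d ≢ port₂ v → toll i j k v d ≡ k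
    toll₃ {i} {j} {k} {v} {d} ne₁ ne₂ = cong₂ (λ b c → if b then i else if c then j else k)
      (dec-false (d ≟ port₁ v) ne₁) (dec-false (d ≟ port₂ v) ne₂)

    hueˡ hueʳ : V → V → Maybe (Fin (4 ℕ.+ q))
    hueˡ v d = just (toll 0F 1F 2F v d ↑ˡ q)
    hueʳ v d = just (toll 2F 1F 0F v d ↑ˡ q)

    entry : ∀ {u v} → Role u → Role v → Maybe (Fin (4 ℕ.+ q))
    entry {u} {v} (core _)    (core _)    = Maybe.map (4 ↑ʳ_) (M u v)
    entry {u} {v} (core _)    (left _ _)  = hueˡ v u
    entry {u} {v} (core _)    (right _ _) = hueʳ v u
    entry {u} {v} (left _ _)  (core _)    = hueˡ u v
    entry         (left _ _)  (left _ _)  = nothing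
    entry         (left _ _)  (right _ _) = just 3F
    entry {u} {v} (right _ _) (core _)    = hueʳ u v
    entry         (right _ _) (left _ _)  = just 3F
    entry         (right _ _) (right _ _) = nothing

    M′ : V → V → Maybe (Fin (4 ℕ.+ q))
    M′ u v = entry (role u) (role v)

    M′-sym : ∀ u v → M′ u v ≡ M′ v u
    M′-sym u v with role u | role v
    ... | core _    | core _    = cong (Maybe.map (4 ↑ʳ_)) (M-sym u v)
    ... | core _    | left _ _  = refl
    ... | core _    | right _ _ = refl
    ... | left _ _  | core _    = refl
    ... | left _ _  | left _ _  = refl
    ... | left _ _  | right _ _ = refl
    ... | right _ _ | core _    = refl
    ... | right _ _ | left _ _  = refl
    ... | right _ _ | right _ _ = refl

    agrees : ∀ {u v} → u ∈ D → v ∈ D → M′ u v ≡ Maybe.map (4 ↑ʳ_) (M u v)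
    agrees {u} {v} u∈ v∈ with role u | role v
    ... | core _     | core _     = refl
    ... | left u∉ _  | _          = contradiction u∈ u∉
    ... | right u∉ _ | _          = contradiction u∈ u∉
    ... | core _     | left v∉ _  = contradiction v∈ v∉
    ... | core _     | right v∉ _ = contradiction v∈ v∉

    open Extension {p = 4} {D′ = allFin n} M′ (λ _ → ∈-allFin _) agrees join

    newˡ : ∀ {u d l} → u ∉ D → u ∈ U → d ∈ D → u ~ d → toll 0F 1F 2F u d ≡ l → New (u , d) l
    newˡ {u} {d} u∉ u∈U d∈ e refl = coloured e (∈-allFin u) (∈-allFin d) hue
      where
      hue : M′ u d ≡ hueˡ u d
      hue with role u | role d
      ... | left _ _    | core _     = refl
      ... | core u∈     | _          = contradiction u∈ u∉
      ... | right _ u∉U | _          = contradiction u∈U u∉U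
      ... | left _ _    | left d∉ _  = contradiction d∈ d∉
      ... | left _ _    | right d∉ _ = contradiction d∈ d∉

    newʳ : ∀ {u d l} → u ∉ D → u ∉ U → d ∈ D → u ~ d → toll 2F 1F 0F u d ≡ l → New (u , d) l
    newʳ {u} {d} u∉ u∉U d∈ e refl = coloured e (∈-allFin u) (∈-allFin d) hue
      where
      hue : M′ u d ≡ hueʳ u d
      hue with role u | role d
      ... | right _ _   | core _     = refl
      ... | core u∈     | _          = contradiction u∈ u∉
      ... | left _ u∈U  | _          = contradiction u∈U u∉U
      ... | right _ _   | left d∉ _  = contradiction d∈ d∉
      ... | right _ _   | right d∉ _ = contradiction d∈ d∉

    crossing : ∀ {u w} → u ∉ D → u ∈ U → w ∉ D → w ∉ U → u ~ w → New (u , w) 3F × New (w , u) 3F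
    crossing {u} {w} u∉ u∈U w∉ w∉U e =
      coloured e (∈-allFin u) (∈-allFin w) hue ,
      coloured (~-sym e) (∈-allFin w) (∈-allFin u) (trans (M′-sym w u) hue)
      where
      hue : M′ u w ≡ just 3F
      hue with role u | role w
      ... | left _ _    | right _ _  = refl
      ... | core u∈     | _          = contradiction u∈ u∉
      ... | right _ u∉U | _          = contradiction u∈U u∉U
      ... | left _ _    | core w∈    = contradiction w∈ w∉
      ... | left _ _    | left _ w∈U = contradiction w∈U w∉U

    data Exits (v : V) : Set where
      exitsˡ : Way v [ 0F ] → Way v [ 1F ] → Way v (3F ∷ 2F ∷ []) → Exits v
      exitsʳ : Way v [ 2F ] → Way v [ 1F ] → Way v (3F ∷ 0F ∷ []) → Exits v

    exits : ∀ v → Exits v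
    exits v with role v
    -- A vertex of `D` fits every budget, so filing it on the left is an arbitrary choice.
    ... | core v∈ = exitsˡ (stay v∈) (stay v∈) (stay v∈)
    ... | left v∉ v∈U with port-props v∉
    ...   | p∈ , r∈ , _ , v~p , v~r = exitsˡ
      (one (newˡ v∉ v∈U p∈ v~p (toll₁ v)) p∈ (here refl))
      (one (newˡ v∉ v∈U r∈ v~r (toll₂ v∉)) r∈ (here refl))
      third
      where
      third : Way v (3F ∷ 2F ∷ [])
      -- The third neighbour cannot lie in the independent set `U`. It is in `D`, at cost 2, or on
      -- the right, from where its first port costs 2 after the crossing.
      third with avoiding-neighbour δ≥3 v (port₁ v) (port₂ v)
      ... | c , v~c , ne₁ , ne₂ with role c
      ...   | core c∈ = one (newˡ v∉ v∈U c∈ v~c (toll₃ ne₁ ne₂)) c∈ (there (here refl))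
      ...   | left _ c∈U = contradiction v~c (indep v∈U c∈U)
      ...   | right c∉ c∉U = let c₁∈ , _ , _ , c~ , _ = port-props c∉ in
        two (proj₁ (crossing v∉ v∈U c∉ c∉U v~c)) (newʳ c∉ c∉U c₁∈ c~ (toll₁ c)) (λ ()) c₁∈
    exits v | right v∉ v∉U with port-props v∉
    ...   | p∈ , r∈ , _ , v~p , v~r = exitsʳ
      (one (newʳ v∉ v∉U p∈ v~p (toll₁ v)) p∈ (here refl))
      (one (newʳ v∉ v∉U r∈ v~r (toll₂ v∉)) r∈ (here refl))
      third
      where
      third : Way v (3F ∷ 0F ∷ [])
      -- Here the detour comes from the maximality of `U`: `v` has a neighbour in `U`, whose first
      -- port costs 0.
      third with dom (∈-filter⁺ (λ v → ¬? (v ∈? D)) (∈-allFin v) v∉)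
      ... | inj₁ v∈U = contradiction v∈U v∉U
      ... | inj₂ (u , u∈U , v~u) =
        let u∉ = proj₂ (∈-filter⁻ (λ v → ¬? (v ∈? D)) {xs = allFin n} (U⊆ u∈U))
            u₁∈ , _ , _ , u~ , _ = port-props u∉
        in
        two (proj₂ (crossing u∉ u∈U v∉ v∉U (~-sym v~u))) (newˡ u∉ u∈U u₁∈ u~ (toll₁ u)) (λ ()) u₁∈

    join′ : ∀ {a b d} → Exits a → Exits b → Exits d → Joins M′ (allFin n) a b d
    -- Only three vertices of one side use the detour. In a mixed triple the lone vertex takes the
    -- first label of its side, and the other two take the first label of theirs and 1.
    join′ (exitsˡ a _ _) (exitsˡ _ b _) (exitsˡ _ _ d) = combine a b d
    join′ (exitsˡ a _ _) (exitsˡ _ b _) (exitsʳ d _ _) = combine a b d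
    join′ (exitsˡ a _ _) (exitsʳ b _ _) (exitsˡ _ d _) = combine a b d
    join′ (exitsʳ a _ _) (exitsˡ b _ _) (exitsˡ _ d _) = combine a b d
    join′ (exitsˡ a _ _) (exitsʳ b _ _) (exitsʳ _ d _) = combine a b d
    join′ (exitsʳ a _ _) (exitsˡ b _ _) (exitsʳ _ d _) = combine a b d
    join′ (exitsʳ a _ _) (exitsʳ _ b _) (exitsˡ d _ _) = combine a b d
    join′ (exitsʳ a _ _) (exitsʳ _ b _) (exitsʳ _ _ d) = combine a b d

  -- Linking the whole graph

  Linked-leaves : ∀ {q K} X → Unique X → Linked q K → (∀ {x} → x ∈ X → x ∉ K × ∃[ k ] k ∈ K × x ~ k) →
    Linked (length X ℕ.+ q) (X ++ K)
  Linked-leaves []      _          linked _   = linked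
  Linked-leaves {K = K} (x ∷ X) (x∉X ∷ uniq) linked hyp with hyp (here refl)
  ... | x∉K , k , k∈ , x~k =
    Linked-leaf (Linked-leaves X uniq linked (hyp ∘ there)) (∈-++⁺ʳ X k∈) fresh (~-sym x~k)
    where
    fresh : x ∉ X ++ K
    fresh x∈ = [ (λ x∈X → All.lookup x∉X x∈X refl) , x∉K ]′ (∈-++⁻ X x∈)

  Linked-spanning-tree : Connected G → ∃₂ λ q l → suc q ℕ.≤ n × Linked q l × (∀ v → v ∈ l)
  Linked-spanning-tree ((a , _) , conn)
    with grow (adj G) (λ l → ∃[ q ] suc q ≡ length l × Linked q l) a (0 , refl , Linked-point a)
      (λ p∈ x∉ e (q , eq , linked) → suc q , cong suc eq , Linked-leaf linked p∈ x∉ e)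
  ... | l , (q , eq , linked) , uniq , a∈ , cl = q , l , subst (ℕ._≤ n) (sym eq) (Unique⇒length≤ uniq) , linked ,
    λ v → Closed-Star {ρ = adj G} cl a∈ (conn SubsetP.∈⊤ SubsetP.∈⊤)

  Linked-half : Connected G → P₅C₅-Free G → δ G ≥ 3 → ∃[ q ] 2 ℕ.* q ℕ.≤ 10 ℕ.+ n × Linked q (allFin n)
  Linked-half conn@((a , _) , _) free δ≥3 with dominating-clique conn free
  ... | K , clique , dom with Linked-clique (proj₂ non-empty) clique
    where
    non-empty : ∃[ v ] v ∈ K
    non-empty = [ (λ a∈ → a , a∈) , (λ (k , k∈ , _) → k , k∈) ]′ (dom a)
  ... | q , 2q≤ , linked with half-domination (filter (λ v → ¬? (v ∈? K)) (allFin n))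
    (Unique.filter⁺ (λ v → ¬? (v ∈? K)) (Unique.allFin⁺ n))
  ... | X , half = 4 ℕ.+ (length X ℕ.+ q) , bound ,
    Linked-two-dominated δ≥3
      (Linked-leaves X unique linked (λ x∈ → ∉K (inside x∈) , neighbour-in-K (∉K (inside x∈)))) ports
    where
    open HalfDominating half renaming (half to 2X≤S)
    ∉K? : Decidable (_∉ K)
    ∉K? v = ¬? (v ∈? K)
    S : List V
    S = filter ∉K? (allFin n)
    ∉K : ∀ {v} → v ∈ S → v ∉ K
    ∉K v∈ = proj₂ (∈-filter⁻ ∉K? {xs = allFin n} v∈)
    ∈S : ∀ {v} → v ∉ K → v ∈ S
    ∈S v∉ = ∈-filter⁺ ∉K? (∈-allFin _) v∉

    neighbour-in-K : ∀ {v} → v ∉ K → ∃[ k ] k ∈ K × v ~ k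
    neighbour-in-K {v} v∉ = [ (λ v∈ → contradiction v∈ v∉) , id ]′ (dom v)

    ports : ∀ v → v ∈ X ++ K ⊎ ∃₂ λ d e → d ∈ X ++ K × e ∈ X ++ K × d ≢ e × v ~ d × v ~ e
    ports v with v ∈? K | v ∈? X
    ... | yes v∈ | _      = inj₁ (∈-++⁺ʳ X v∈)
    ... | no _   | yes v∈ = inj₁ (∈-++⁺ˡ v∈)
    ... | no v∉K | no v∉X with covers (∈S v∉K) v∉X
    -- One neighbour comes from the dominating clique and one from `X`; they differ because `X` lies
    -- outside `K`.
    ...   | inj₁ (x , x∈ , v~x) = let k , k∈ , v~k = neighbour-in-K v∉K in
      inj₂ (k , x , ∈-++⁺ʳ X k∈ , ∈-++⁺ˡ x∈ , (λ { refl → ∉K (inside x∈) k∈ }) , v~k , v~x)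
    -- All neighbours of `v` lie in `K`, and the minimum degree yields two distinct ones.
    ...   | inj₂ isolated =
      let c , v~c , _ = avoiding-neighbour δ≥3 v v v
          d , v~d , d≢c , _ = avoiding-neighbour δ≥3 v c c
      in inj₂ (c , d , ∈-++⁺ʳ X (in-K v~c) , ∈-++⁺ʳ X (in-K v~d) , ≢-sym d≢c , v~c , v~d)
      where
      in-K : ∀ {c} → v ~ c → c ∈ K
      in-K {c} v~c = decidable-stable (c ∈? K) (λ c∉ → isolated (∈S c∉) v~c)

    K+S≤n : length K ℕ.+ length S ℕ.≤ n
    K+S≤n = subst (ℕ._≤ n) (ListP.length-++ K) (Unique⇒length≤ (Unique-++ (AllPairs.map ~⇒≢ clique)
      (Unique.filter⁺ ∉K? (Unique.allFin⁺ n)) (λ v∈K v∈S → ∉K v∈S v∈K)))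

    bound : 2 ℕ.* (4 ℕ.+ (length X ℕ.+ q)) ℕ.≤ 10 ℕ.+ n
    bound = begin
      2 ℕ.* (4 ℕ.+ (length X ℕ.+ q))                 ≡⟨ rearrange (length X) q ⟩
      8 ℕ.+ (2 ℕ.* q ℕ.+ 2 ℕ.* length X)             ≤⟨ ℕP.+-monoʳ-≤ 8 (ℕP.+-mono-≤ 2q≤ 2X≤S) ⟩
      10 ℕ.+ (length K ℕ.+ length S)                 ≤⟨ ℕP.+-monoʳ-≤ 10 K+S≤n ⟩
      10 ℕ.+ n                                       ∎
      where
      open ℕP.≤-Reasoning
      open +-*-Solver
      rearrange : ∀ x q → 2 ℕ.* (4 ℕ.+ (x ℕ.+ q)) ≡ 8 ℕ.+ (2 ℕ.* q ℕ.+ 2 ℕ.* x)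
      rearrange = solve 2 (λ x q →
        con 2 :* (con 4 :+ (x :+ q)) := con 8 :+ (con 2 :* q :+ con 2 :* x)) refl

-- Arithmetic of the bound and conclusion

spanning-tree-bound : ∀ {q n} → suc q ℕ.≤ n → n ℕ.≤ 12 → 16 ℕ.* q ℕ.≤ 11 ℕ.* n ℕ.+ 48
spanning-tree-bound {q} {n} q<n n≤12 = ℕP.+-cancelˡ-≤ 11 _ _ (begin
    11 ℕ.+ 16 ℕ.* q                ≡⟨ cong (11 ℕ.+_) (ℕP.*-distribʳ-+ q 11 5) ⟩
    11 ℕ.+ (11 ℕ.* q ℕ.+ 5 ℕ.* q)  ≡⟨ ℕP.+-assoc 11 (11 ℕ.* q) (5 ℕ.* q) ⟨
    11 ℕ.+ 11 ℕ.* q ℕ.+ 5 ℕ.* q    ≡⟨ cong (ℕ._+ 5 ℕ.* q) (ℕP.*-suc 11 q) ⟨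
    -- `q` ≤ 11 gives 5q ≤ 55, within the available 59 = 48 + 11; the 11 added on both sides avoids
    -- subtracting 1 from `n`.
    11 ℕ.* suc q ℕ.+ 5 ℕ.* q       ≤⟨ ℕP.+-mono-≤ (ℕP.*-monoʳ-≤ 11 q<n)
                                        (ℕP.≤-trans (ℕP.*-monoʳ-≤ 5 (ℕP.≤-pred (ℕP.≤-trans q<n n≤12)))
                                          (ℕP.m≤m+n 55 4)) ⟩
    11 ℕ.* n ℕ.+ 59                ≡⟨ ℕP.+-assoc (11 ℕ.* n) 48 11 ⟨
    11 ℕ.* n ℕ.+ 48 ℕ.+ 11         ≡⟨ ℕP.+-comm _ 11 ⟩
    11 ℕ.+ (11 ℕ.* n ℕ.+ 48)       ∎)
  where open ℕP.≤-Reasoning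

half-bound : ∀ {q n} → 2 ℕ.* q ℕ.≤ 10 ℕ.+ n → 12 ℕ.< n → 16 ℕ.* q ℕ.≤ 11 ℕ.* n ℕ.+ 48
half-bound {q} {n} 2q≤ 12<n = begin
    16 ℕ.* q                        ≡⟨ ℕP.*-assoc 8 2 q ⟩
    8 ℕ.* (2 ℕ.* q)                 ≤⟨ ℕP.*-monoʳ-≤ 8 2q≤ ⟩
    8 ℕ.* (10 ℕ.+ n)                ≡⟨ ℕP.*-distribˡ-+ 8 10 n ⟩
    -- The excess of 80 over 48 is 32, and `n` ≥ 13 gives 3n ≥ 39.
    80 ℕ.+ 8 ℕ.* n                  ≤⟨ ℕP.+-monoˡ-≤ (8 ℕ.* n) (ℕP.+-monoʳ-≤ 48
                                         (ℕP.≤-trans (ℕP.m≤m+n 32 7) (ℕP.*-monoʳ-≤ 3 12<n))) ⟩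
    48 ℕ.+ 3 ℕ.* n ℕ.+ 8 ℕ.* n      ≡⟨ ℕP.+-assoc 48 (3 ℕ.* n) (8 ℕ.* n) ⟩
    48 ℕ.+ (3 ℕ.* n ℕ.+ 8 ℕ.* n)    ≡⟨ cong (48 ℕ.+_) (ℕP.*-distribʳ-+ n 3 8) ⟨
    48 ℕ.+ 11 ℕ.* n                 ≡⟨ ℕP.+-comm 48 _ ⟩
    11 ℕ.* n ℕ.+ 48                 ∎
  where open ℕP.≤-Reasoning

few-colours : ∀ {n} (G : Graph n) → Connected G → P₅C₅-Free G → δ G ≥ 3 →
  ∃[ q ] 16 ℕ.* q ℕ.≤ 11 ℕ.* n ℕ.+ 48 × Has3RainbowColouring G q
few-colours {n} G conn@((a , _) , _) free δ≥3 = [ small , large ]′ (ℕP.≤-<-connex n 12)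
  where
  coloured-by : ∀ {q l} → 16 ℕ.* q ℕ.≤ 11 ℕ.* n ℕ.+ 48 → Linked G q l → (∀ v → v ∈ l) →
    ∃[ q ] 16 ℕ.* q ℕ.≤ 11 ℕ.* n ℕ.+ 48 × Has3RainbowColouring G q
  coloured-by {q} bound linked all∈ = let b , a~b , _ = avoiding-neighbour G δ≥3 a a a in
    q , bound , Linked⇒colouring G linked all∈ (Linked-colour G linked (all∈ a) (all∈ b) (~⇒≢ G a~b))

  small : n ℕ.≤ 12 → ∃[ q ] 16 ℕ.* q ℕ.≤ 11 ℕ.* n ℕ.+ 48 × Has3RainbowColouring G q
  small n≤12 = let q , _ , q<n , linked , all∈ = Linked-spanning-tree G conn in
    coloured-by (spanning-tree-bound q<n n≤12) linked all∈

  large : 12 ℕ.< n → ∃[ q ] 16 ℕ.* q ℕ.≤ 11 ℕ.* n ℕ.+ 48 × Has3RainbowColouring G q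
  large 12<n = let q , 2q≤ , linked = Linked-half G conn free δ≥3 in
    coloured-by (half-bound {q} 2q≤ 12<n) linked ∈-allFin

≤-bound : ∀ {r n} → 16 ℕ.* r ℕ.≤ 11 ℕ.* n ℕ.+ 48 → + r / 1 ≤ (+ 11 / 16) * (+ n / 1) + (+ 3 / 1)
-- Unnormalised fractions are compared by cross-multiplication; the common denominator 16 turns the
-- summand 3 into 48.
≤-bound {r} {n} le = *≤* (subst₂ ℤ._≤_ lhs rhs (ℤ.+≤+ le))
  where
  lhs : + (16 ℕ.* r) ≡ + r ℤ.* + 16
  lhs = trans (cong +_ (ℕP.*-comm 16 r)) (ℤP.pos-* r 16)
  rhs : + (11 ℕ.* n ℕ.+ 48) ≡ ((+ 11 ℤ.* + n) ℤ.* + 1 ℤ.+ + 48) ℤ.* + 1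
  rhs = sym (trans (ℤP.*-identityʳ _) (cong (ℤ._+ + 48) (trans (ℤP.*-identityʳ _) (sym (ℤP.pos-* 11 n)))))

theorem3p4 : ∀ (n : ℕ) (G : Graph n) → Connected G → P₅C₅-Free G → δ G ≥ 3 →
    ∃[ r ] Is3RainbowIndex G r × (+ r / 1 ≤ (+ 11 / 16) * (+ n / 1) + (+ 3 / 1))
theorem3p4 n G conn free δ≥3 =
  let q , bound , colouring = few-colours G conn free δ≥3
      r , has , minimal     = least (has3RainbowColouring? G) q colouring
  in r , (has , minimal) , ≤-bound {r} {n} (ℕP.≤-trans (ℕP.*-monoʳ-≤ 16 (minimal q colouring)) bound)
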